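{- The scheduling problem $P \mid\mid \Sigma w_j U_j$ (minimizing the total weight of tardy jobs among $n$ jobs on $m$ identical parallel machines, with $m$ part of the input) can be solved in time $O^{\star}(2^n)$, where $n$ is the number of jobs.
   Context: Problem $P \mid\mid \Sigma w_j U_j$. Input: $n$ jobs, where job $j \in \{1,\dots,n\}$ has a processing time $p_j \in \mathbb{N}$, a weight $w_j \in \mathbb{N}$ and a due date $d_j \in \mathbb{N}$; a number of machines $m \in \mathbb{N}$ with $m \ge 1$. Here $\mathbb{N}$ contains $0$. A schedule assigns each job to a machine and a starting time (at least $0$) such that no two jobs are processed at the same time by the same machine; once started, job $j$ runs for $p_j$ time units, and $C_j$ denotes its completion time. Let $U_j = 1$ if $C_j > d_j$ (job $j$ is tardy) and $U_j = 0$ otherwise. Task: compute the minimum of $\sum_{j=1}^n w_j U_j$ over all schedules of the $n$ jobs on the $m$ identical parallel machines. A function $f(n)$ is in $O^{\star}(g(n))$ if it is in $O(g(n)\cdot n^c)$ for some constant $c$. Computation model: unit-cost RAM with word size $\Theta(L)$ bits, where $L$ is the encoding length of the input, so arithmetic operations on integers with $O(L)$ bits take constant time. -}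

module Defs where

import Algebra.Properties.CommutativeMonoid.Sum
open import Data.Bool using (if_then_else_)
open import Data.Fin using (Fin)
open import Data.Integer using (+_)
open import Data.List using (List; []; _∷_; map; concatMap; allFin)
import Data.Nat.ListAction as List
open import Data.Maybe using (Maybe; just; nothing; fromMaybe)
open import Data.Nat
open import Data.Nat.Logarithm using (⌊log₂_⌋)
open import Data.Nat.Properties using (_≟_; _<?_; m^n≢0; +-0-commutativeMonoid)
open import Data.Product using (_×_; ∃-syntax)
open import Data.Rational using (ℚ; 0ℚ)
import Data.Rational as ℚ
import Data.Rational.Properties as ℚ
open import Relation.Binary.PropositionalEquality using (_≡_; _≢_)
open import Relation.Nullary using (¬_; does)

open Algebra.Properties.CommutativeMonoid.Sum +-0-commutativeMonoid using (sum)

infix 4 _∈O_ _∈O*_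

_∈O_ : (ℕ → ℕ) → (ℕ → ℕ) → Set
f ∈O g = ∃[ K ] ∃[ n₀ ] (∀ n → n₀ ≤ n → f n ≤ K * g n)

_∈O*_ : (ℕ → ℕ) → (ℕ → ℕ) → Set
f ∈O* g = ∃[ c ] (f ∈O λ n → g n * n ^ c)

-- Registers are numbered by ℕ, but register numbers are never computed, so
-- a program uses finitely many of them; only the memory is addressed
-- indirectly.
Reg : Set
Reg = ℕ

data Op : Set where
  add sub mul div : Op

-- Jump targets are absolute positions in the program.
data Instr : Set where
  const     : (dst : Reg) (k : ℕ) → Instr
  arith     : Op → (dst src₁ src₂ : Reg) → Instr
  load      : (dst addr : Reg) → Instr
  store     : (addr src : Reg) → Instr
  jump      : (target : ℕ) → Instr
  jumpIf<   : (src₁ src₂ : Reg) (target : ℕ) → Instr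
  jumpIf≡   : (src₁ src₂ : Reg) (target : ℕ) → Instr
  halt      : Instr

Program : Set
Program = List Instr

record Config : Set where
  constructor ⟨_,_,_⟩
  field
    pc   : ℕ
    regs : ℕ → ℕ
    mem  : ℕ → ℕ

open Config public

_‼_ : ∀ {A : Set} → List A → ℕ → Maybe A
[]       ‼ _     = nothing
(x ∷ xs) ‼ zero  = just x
(x ∷ xs) ‼ suc i = xs ‼ i

_[_≔_] : (ℕ → ℕ) → ℕ → ℕ → (ℕ → ℕ)
(f [ i ≔ v ]) j = if does (j ≟ i) then v else f j

-- Subtraction is cut off at 0, and division is integer division, with
-- quotient 0 when the divisor is 0.
evalOp : Op → ℕ → ℕ → ℕ
evalOp add x y       = x + y
evalOp sub x y       = x ∸ y
evalOp mul x y       = x * y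
evalOp div x zero    = 0
evalOp div x (suc y) = x / suc y

truncate : (wordSize : ℕ) → ℕ → ℕ
truncate W x = _%_ x (2 ^ W) {{m^n≢0 2 W}}

exec : (wordSize : ℕ) → Instr → Config → Maybe Config
exec W (const d k)     ⟨ pc , r , μ ⟩ =
  just ⟨ suc pc , r [ d ≔ truncate W k ] , μ ⟩
exec W (arith o d a b) ⟨ pc , r , μ ⟩ =
  just ⟨ suc pc , r [ d ≔ truncate W (evalOp o (r a) (r b)) ] , μ ⟩
exec W (load d a)      ⟨ pc , r , μ ⟩ =
  just ⟨ suc pc , r [ d ≔ μ (r a) ] , μ ⟩
exec W (store a s)     ⟨ pc , r , μ ⟩ =
  just ⟨ suc pc , r , μ [ r a ≔ r s ] ⟩
exec W (jump l)        ⟨ pc , r , μ ⟩ =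
  just ⟨ l , r , μ ⟩
exec W (jumpIf< a b l) ⟨ pc , r , μ ⟩ =
  just ⟨ (if does (r a <? r b) then l else suc pc) , r , μ ⟩
exec W (jumpIf≡ a b l) ⟨ pc , r , μ ⟩ =
  just ⟨ (if does (r a ≟ r b) then l else suc pc) , r , μ ⟩
exec W halt            _              = nothing

-- Run W P c v t: with word size W, the program P started in c reaches a
-- halt instruction with v in register 0, having executed t instructions.
-- A program whose pc leaves the code is stuck and has no run.
data Run (W : ℕ) (P : Program) (c : Config) : ℕ → ℕ → Set where
  stop : P ‼ pc c ≡ just halt → Run W P c (regs c 0) 1
  step : ∀ {i c′ v t} → P ‼ pc c ≡ just i → exec W i c ≡ just c′ →
         Run W P c′ v t → Run W P c v (suc t)

initial : List ℕ → Config
initial input = ⟨ 0 , (λ _ → 0) , (λ i → fromMaybe 0 (input ‼ i)) ⟩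

-- Length of the binary notation of k; 0 is written with one digit.
bits : ℕ → ℕ
bits k = 1 + ⌊log₂ k ⌋

encodingLength : List ℕ → ℕ
encodingLength input = List.sum (map bits input)

record Problem : Set₁ where
  field
    -- Instances, indexed by the parameter in which time is measured.
    Instance : ℕ → Set
    encode   : ∀ {n} → Instance n → List ℕ
    IsAnswer : ∀ {n} → Instance n → ℕ → Set

-- The program and the factor a in the word size a · L = Θ(L) do not depend
-- on the instance.
_SolvableInTime_ : Problem → (ℕ → ℕ) → Set
Π SolvableInTime T =
  ∃[ P ] ∃[ a ] (NonZero a ×
    (∀ {n} (I : Instance n) → ∃[ v ] ∃[ t ]
      (Run (a * encodingLength (encode I)) P (initial (encode I)) v t ×
       IsAnswer I v × t ≤ T n)))
  where open Problem Π

record Jobs (n : ℕ) : Set where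
  field
    m   : ℕ
    m≥1 : 1 ≤ m
    p   : Fin n → ℕ
    w   : Fin n → ℕ
    d   : Fin n → ℕ

fromℕ : ℕ → ℚ
fromℕ k = + k ℚ./ 1

module _ {n : ℕ} (I : Jobs n) where
  open Jobs I

  module _ (start : Fin n → ℚ) where

    completion : Fin n → ℚ
    completion j = start j ℚ.+ fromℕ (p j)

    -- Job j occupies the half-open interval [start j , completion j).
    InProcess : Fin n → ℚ → Set
    InProcess j t = start j ℚ.≤ t × t ℚ.< completion j

    U : Fin n → ℕ
    U j = if does (fromℕ (d j) ℚ.<? completion j) then 1 else 0

  record Schedule : Set where
    field
      machine   : Fin n → Fin m
      start     : Fin n → ℚ
      start≥0   : ∀ j → 0ℚ ℚ.≤ start j
      noOverlap : ∀ i j → i ≢ j → machine i ≡ machine j →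
                  ∀ t → ¬ (InProcess start i t × InProcess start j t)

  tardyWeight : Schedule → ℕ
  tardyWeight σ = sum (λ j → w j * U (Schedule.start σ) j)

  IsMinTardyWeight : ℕ → Set
  IsMinTardyWeight v =
    (∃[ σ ] tardyWeight σ ≡ v) × (∀ σ → v ≤ tardyWeight σ)

encodeJobs : ∀ {n} → Jobs n → List ℕ
encodeJobs {n} I =
  n ∷ m ∷ concatMap (λ j → p j ∷ w j ∷ d j ∷ []) (allFin n)
  where open Jobs I

P‖ΣwU : Problem
P‖ΣwU = record
  { Instance = Jobs
  ; encode   = encodeJobs
  ; IsAnswer = IsMinTardyWeight
  }

{-# OPTIONS --safe #-}
module Submission where

-- Dynamic programming over the sets S of jobs to be early. Pack the machines
-- one after the other, and encode "machines 0 … k−1 are closed and machine k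
-- is busy until c" as the number k B + c, where B exceeds all due dates. Then
-- the least number t(S) reachable with all of S on time satisfies
--   t(S) = min over j ∈ S of the result of appending j to t(S ∖ {j}),
-- where j goes to machine k if it ends there by d j and otherwise opens a new
-- machine: appending is monotone, so a smaller t(S ∖ {j}) is never worse. S can
-- be early on m machines iff t(S) < m B, and the answer is the least weight
-- outside such an S. With S as a bit mask this takes O(n) steps for each of
-- the 2ⁿ sets.

import Algebra.Properties.CommutativeMonoid.Sum
open import Data.Bool using (Bool; true; false; if_then_else_; not)
import Data.Bool.Properties as Bool
open import Data.Empty using (⊥-elim) renaming (⊥ to Empty)
open import Data.Fin using (Fin; zero; suc; toℕ; fromℕ<)
import Data.Fin.Properties as Fin
open import Data.Fin.Subset using (Subset; ⊥)
import Data.Integer as ℤ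
import Data.Integer.Properties as ℤ
open import Data.List as List using (List; []; _∷_)
open import Data.Maybe using (Maybe; just; fromMaybe)
open import Data.Nat
import Data.Nat.Coprimality as Coprime
open import Data.Nat.DivMod hiding (_div_; _mod_)
import Data.Nat.ListAction as ListAction
open import Data.Nat.Logarithm using (⌊log₂_⌋; ⌊log₂[2^n]⌋≡n; ⌊log₂⌋-mono-≤)
open import Data.Nat.Properties
open import Data.Nat.Solver using (module +-*-Solver)
open import Data.Product using (_×_; _,_; proj₁; proj₂; ∃-syntax)
open import Data.Rational using (ℚ; 0ℚ)
import Data.Rational as ℚ
import Data.Rational.Properties as ℚ
open import Data.Sum as Sum using (_⊎_; inj₁; inj₂; [_,_]′)
open import Data.Unit using (⊤; tt)
open import Data.Vec using (Vec; []; _∷_; lookup; _[_]≔_; tabulate; toList)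
open import Data.Vec.Functional using (updateAt)
open import Data.Vec.Functional.Properties using (updateAt-updates; updateAt-minimal)
open import Data.Vec.Properties using (lookup∘update; lookup∘update′; lookup-replicate; lookup∘tabulate)
open import Function using (_∘_; _$_)
open import Relation.Binary using (tri<; tri≈; tri>)
open import Relation.Binary.PropositionalEquality
open import Relation.Nullary
open import Relation.Nullary.Decidable using (dec-true; dec-false)
open import Defs

open +-*-Solver using (solve; _:=_; _:+_; _:*_; con)
open Algebra.Properties.CommutativeMonoid.Sum +-0-commutativeMonoid using (sum; sum-cong-≗)

-- Turning a schedule into a packing is the delicate direction. Start times are rational, and a job
-- of length 0 occupies an empty interval, so it may sit inside another job; the jobs of a machine
-- need not form a sequence of blocks. The remedy is to take the early jobs of each machine in the
-- order of their completion times and to push them together from time 0: each then ends at the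
-- total length so far, which is at most its old completion time and is a natural number.
--
-- The number `m * B` doubles as infinity. Every table entry starts there and is replaced only by
-- smaller candidates, so numbers do not pile up over the exponentially many sets: all of them stay
-- below a quadratic expression in quantities read off the input. This is what lets a word of three
-- times the encoding length suffice and makes every truncation of the machine harmless.

private variable
  n : ℕ

-- Subsets as binary numbers

bit : Bool → ℕ
bit b = if b then 1 else 0

code : Subset n → ℕ
code []      = 0
code (b ∷ S) = bit b + 2 * code S

bit≤1 : ∀ b → bit b ≤ 1
bit≤1 false = z≤n
bit≤1 true  = s≤s z≤n

code<2^n : (S : Subset n) → code S < 2 ^ n
code<2^n []      = s≤s z≤n
code<2^n {suc n} (b ∷ S) = begin-strict
  bit b + 2 * code S   ≤⟨ +-monoˡ-≤ _ (bit≤1 b) ⟩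
  1 + 2 * code S       <⟨ n<1+n _ ⟩
  2 + 2 * code S       ≡⟨ *-suc 2 (code S) ⟨
  2 * suc (code S)     ≤⟨ *-monoʳ-≤ 2 (code<2^n S) ⟩
  2 * 2 ^ n            ∎
  where open ≤-Reasoning

code/2 : ∀ b (S : Subset n) → code (b ∷ S) / 2 ≡ code S
code/2 b S = begin
  (bit b + 2 * code S) / 2       ≡⟨ cong (λ x → (bit b + x) / 2) (*-comm 2 (code S)) ⟩
  (bit b + code S * 2) / 2       ≡⟨ +-distrib-/ (bit b) _ (small b) ⟩
  bit b / 2 + code S * 2 / 2     ≡⟨ cong₂ _+_ (m<n⇒m/n≡0 (s≤s (bit≤1 b))) (m*n/n≡m (code S) 2) ⟩
  code S                         ∎
  where
  open ≡-Reasoning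
  small : ∀ b → bit b % 2 + (code S * 2) % 2 < 2
  small false rewrite m*n%n≡0 (code S) 2 ⦃ _ ⦄ = s≤s z≤n
  small true  rewrite m*n%n≡0 (code S) 2 ⦃ _ ⦄ = s≤s (s≤s z≤n)

code-injective : (S S′ : Subset n) → code S ≡ code S′ → S ≡ S′
code-injective []      []        _  = refl
code-injective (b ∷ S) (b′ ∷ S′) eq = cong₂ _∷_ (bit-injective b b′ bit≡) tails
  where
  tails : S ≡ S′
  tails = code-injective S S′
    (trans (sym (code/2 b S)) (trans (cong (_/ 2) eq) (code/2 b′ S′)))

  bit≡ : bit b ≡ bit b′
  bit≡ = +-cancelʳ-≡ (2 * code S) _ _
    (trans eq (cong (λ T → bit b′ + 2 * code T) (sym tails)))

  bit-injective : ∀ b b′ → bit b ≡ bit b′ → b ≡ b′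
  bit-injective false false _ = refl
  bit-injective true  true  _ = refl

decode : ∀ n s → s < 2 ^ n → ∃[ S ] code {n} S ≡ s
decode zero    zero s<1 = [] , refl
decode zero    (suc _) (s≤s ())
decode (suc n) s s<2^n = b ∷ S , (begin
  bit b + 2 * code S    ≡⟨ cong₂ (λ x y → x + 2 * y) bit≡ code≡ ⟩
  s % 2 + 2 * (s / 2)   ≡⟨ cong (s % 2 +_) (*-comm 2 (s / 2)) ⟩
  s % 2 + s / 2 * 2     ≡⟨ m≡m%n+[m/n]*n s 2 ⟨
  s                     ∎)
  where
  open ≡-Reasoning
  half : ∃[ S ] code S ≡ s / 2
  half = decode n (s / 2) (m<n*o⇒m/o<n (subst (s <_) (*-comm 2 (2 ^ n)) s<2^n))
  S     = proj₁ half
  code≡ = proj₂ half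
  digit : ∀ {r} → r < 2 → ∃[ b ] bit b ≡ r
  digit {0} _ = false , refl
  digit {1} _ = true , refl
  digit {suc (suc _)} (s≤s (s≤s ()))
  b    = proj₁ (digit (m%n<n s 2))
  bit≡ = proj₂ (digit (m%n<n s 2))

code-remove : ∀ (S : Subset n) j → lookup S j ≡ true → code (S [ j ]≔ false) + 2 ^ toℕ j ≡ code S
code-remove (true ∷ S) zero    _  = +-comm (2 * code S) 1
code-remove (b ∷ S)    (suc j) j∈ = begin
  bit b + 2 * code (S [ j ]≔ false) + 2 * 2 ^ toℕ j   ≡⟨ +-assoc (bit b) _ _ ⟩
  bit b + (2 * code (S [ j ]≔ false) + 2 * 2 ^ toℕ j) ≡⟨ cong (bit b +_) (*-distribˡ-+ 2 (code (S [ j ]≔ false)) _) ⟨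
  bit b + 2 * (code (S [ j ]≔ false) + 2 ^ toℕ j)     ≡⟨ cong (λ x → bit b + 2 * x) (code-remove S j j∈) ⟩
  bit b + 2 * code S                                  ∎
  where open ≡-Reasoning

-- Removing a job lowers the mask, so when masks are taken in increasing order every entry that S
-- consults is final. The same decrease ends the recursions over subsets in the treatment of
-- schedules.
code-remove-< : ∀ (S : Subset n) j → lookup S j ≡ true → code (S [ j ]≔ false) < code S
code-remove-< S j j∈ = subst (code (S [ j ]≔ false) <_) (code-remove S j j∈)
  (m<m+n _ (m^n>0 2 (toℕ j)))

empty-code : ∀ n → code (⊥ {n}) ≡ 0
empty-code zero    = refl
empty-code (suc n) = cong (2 *_) (empty-code n)

lookup⇒≡⊥ : (S : Subset n) → (∀ j → lookup S j ≢ true) → S ≡ ⊥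
lookup⇒≡⊥ []          _   = refl
lookup⇒≡⊥ (true ∷ S)  j∉  = ⊥-elim (j∉ zero refl)
lookup⇒≡⊥ (false ∷ S) j∉  = cong (false ∷_) (lookup⇒≡⊥ S (j∉ ∘ suc))

∈⊥-absurd : ∀ (j : Fin n) → lookup ⊥ j ≢ true
∈⊥-absurd {n = suc n} j j∈ with () ← trans (sym (lookup-replicate j false)) j∈

∈-remove : ∀ (S : Subset n) {i j} → lookup S i ≡ true → i ≢ j → lookup (S [ j ]≔ false) i ≡ true
∈-remove S {i} {j} i∈ i≢j = trans (lookup∘update′ i≢j S false) i∈

remove-∈ : ∀ (S : Subset n) {i j} → lookup (S [ j ]≔ false) i ≡ true → i ≢ j × lookup S i ≡ true
remove-∈ S {i} {j} i∈ = i≢j , trans (sym (lookup∘update′ i≢j S false)) i∈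
  where
  i≢j : i ≢ j
  i≢j refl with () ← trans (sym (lookup∘update i S false)) i∈

-- Finite sums

sum-mono-≤ : {f g : Fin n → ℕ} → (∀ j → f j ≤ g j) → sum f ≤ sum g
sum-mono-≤ {zero}  _  = z≤n
sum-mono-≤ {suc n} le = +-mono-≤ (le zero) (sum-mono-≤ (le ∘ suc))

≤sum : (f : Fin n → ℕ) → ∀ j → f j ≤ sum f
≤sum f zero    = m≤m+n (f zero) _
≤sum f (suc j) = ≤-trans (≤sum (f ∘ suc) j) (m≤n+m _ (f zero))

sum-isolate : (f g : Fin n → ℕ) → ∀ j → (∀ i → i ≢ j → f i ≡ g i) → g j ≡ 0 → sum f ≡ sum g + f j
sum-isolate f g zero    f≡g gj≡0 rewrite gj≡0 =
  trans (cong (f zero +_) (sum-cong-≗ (λ i → f≡g (suc i) λ ()))) (+-comm (f zero) _)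
sum-isolate f g (suc j) f≡g gj≡0 =
  trans (cong₂ _+_ (f≡g zero λ ()) (sum-isolate (f ∘ suc) (g ∘ suc) j (λ i i≢j → f≡g (suc i) (λ { refl → i≢j refl })) gj≡0))
        (sym (+-assoc (g zero) _ _))

sum-zero : (f : Fin n → ℕ) → (∀ j → f j ≡ 0) → sum f ≡ 0
sum-zero {zero}  f _  = refl
sum-zero {suc n} f f≡0 rewrite f≡0 zero = sum-zero (f ∘ suc) (f≡0 ∘ suc)

outsideSum : (Fin n → ℕ) → Subset n → ℕ
outsideSum f S = sum (λ j → if lookup S j then 0 else f j)

-- Packings and the recurrence for their least code

module Packings {n : ℕ} (p d : Fin n → ℕ) where

  -- Packing S k c: the jobs of S can be started on time on machines 0 … k,
  -- one machine after the other, machine k being busy until time c.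
  data Packing : Subset n → ℕ → ℕ → Set where
    empty : Packing ⊥ 0 0
    next  : ∀ {S k c} → Packing S k c → Packing S (suc k) 0
    place : ∀ {S k c} j → lookup S j ≡ true → Packing (S [ j ]≔ false) k c →
            c + p j ≤ d j → Packing S k (c + p j)

  load≤ : ∀ {D S k c} → (∀ j → d j ≤ D) → Packing S k c → c ≤ D
  load≤ d≤D empty             = z≤n
  load≤ d≤D (next _)          = z≤n
  load≤ d≤D (place j _ _ fit) = ≤-trans fit (d≤D j)

  module Table (D m : ℕ) (d≤D : ∀ j → d j ≤ D) where

    B cap : ℕ
    B   = suc D
    cap = m * B

    -- Nothing is asked of the value `cap`, which plays the part of infinity. The bound `c < B`
    -- makes `k` and `c` the quotient and the remainder of `v`.
    record Attains (S : Subset n) (v : ℕ) : Set where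
      constructor attains
      field
        capped   : v ≤ cap
        attained : v < cap → ∃[ k ] ∃[ c ] (Packing S k c × c < B × v ≡ k * B + c)

    -- This pins `v` to the smaller of `cap` and the least code of a packing of S.
    record Optimal (S : Subset n) (v : ℕ) : Set where
      constructor optimal
      field
        attaining : Attains S v
        lower     : ∀ {k c} → Packing S k c → v ≤ k * B + c
      open Attains attaining public

    -- The share of `lower` that concerns packings whose last step places `j`; the inner loop of the
    -- program establishes it one job at a time.
    LowerFor : Subset n → ℕ → Fin n → Set
    LowerFor S v j = ∀ {k c} → lookup S j ≡ true → Packing (S [ j ]≔ false) k c → c + p j ≤ d j →
                     v ≤ k * B + (c + p j)

    optimal-⊥ : Optimal ⊥ 0
    optimal-⊥ = optimal (attains z≤n λ _ → 0 , 0 , empty , s≤s z≤n , refl) (λ _ → z≤n)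

    -- A packing of a non-empty set ends with a placed job, followed only by `next` steps. Each of
    -- these raises the code, since a load is at most `D` and thus below `B`.
    optimal-step : ∀ {S v} → S ≢ ⊥ → Attains S v → (∀ j → LowerFor S v j) → Optimal S v
    optimal-step {S} {v} S≢⊥ at low = optimal at lower
      where
      lower : ∀ {k c} → Packing S k c → v ≤ k * B + c
      lower empty              = ⊥-elim (S≢⊥ refl)
      lower (place j j∈ P fit) = low j j∈ P fit
      lower (next {k = k} {c} P) = begin
        v             ≤⟨ lower P ⟩
        k * B + c     ≤⟨ +-monoʳ-≤ (k * B) (m≤n⇒m≤1+n (load≤ d≤D P)) ⟩
        k * B + B     ≡⟨ +-comm (k * B) B ⟩
        suc k * B     ≡⟨ +-identityʳ _ ⟨
        suc k * B + 0 ∎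
        where open ≤-Reasoning

    module Append {S j u} (j∈S : lookup S j ≡ true) (opt : Optimal (S [ j ]≔ false) u) where

      open Optimal opt

      k r : ℕ
      k = u / B
      r = u ∸ k * B

      kB+r≡u : k * B + r ≡ u
      kB+r≡u = m+[n∸m]≡n (m/n*n≤m u B)

      r<B : r < B
      r<B = subst (_< B) (m%n≡m∸m/n*n u B) (m%n<n u B)

      -- Loads below `B` make the decomposition of a code unique, so the quotient and remainder that
      -- the program computes belong to an actual packing.
      split : u < cap → Packing (S [ j ]≔ false) k r
      split u<cap with attained u<cap
      ... | k′ , r′ , P , r′<B , refl = subst₂ (Packing _) (sym k≡) (sym r≡) P
        where
        k≡ : k ≡ k′
        k≡ = begin
          (k′ * B + r′) / B          ≡⟨ +-distrib-/ (k′ * B) r′ small ⟩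
          k′ * B / B + r′ / B        ≡⟨ cong₂ _+_ (m*n/n≡m k′ B) (m<n⇒m/n≡0 r′<B) ⟩
          k′ + 0                     ≡⟨ +-identityʳ k′ ⟩
          k′                         ∎
          where
          open ≡-Reasoning
          small : (k′ * B) % B + r′ % B < B
          small rewrite m*n%n≡0 k′ B ⦃ _ ⦄ | m<n⇒m%n≡m ⦃ _ ⦄ r′<B = r′<B
        r≡ : r ≡ r′
        r≡ rewrite k≡ = m+n∸m≡n (k′ * B) r′

      same-machine : r + p j ≤ d j → u + p j ≤ cap → Attains S (u + p j)
      same-machine fit le = attains le λ lt →
        k , r + p j , place j j∈S (split (≤-<-trans (m≤m+n u _) lt)) fit ,
        s≤s (≤-trans fit (d≤D j)) ,
        trans (cong (_+ p j) (sym kB+r≡u)) (+-assoc (k * B) r _)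

      -- Placing `j` adds exactly `p j` to the code of any packing, so the bound carries over from
      -- `u` whether or not `j` fits after `u`.
      same-machine-lower : LowerFor S (u + p j) j
      same-machine-lower {k′} {c} _ P _ = ≤-trans (+-monoˡ-≤ (p j) (lower P)) (≤-reflexive (+-assoc (k′ * B) c _))

      next-machine : p j ≤ d j → k * B + B + p j ≤ cap → Attains S (k * B + B + p j)
      next-machine fit le = attains le λ lt →
        suc k , p j ,
        place j j∈S (next (split (≤-<-trans u≤ lt))) fit ,
        s≤s (≤-trans fit (d≤D j)) , cong (_+ p j) (+-comm (k * B) B)
        where
        u≤ : u ≤ k * B + B + p j
        u≤ = begin
          u               ≡⟨ kB+r≡u ⟨
          k * B + r       ≤⟨ +-monoʳ-≤ (k * B) (<⇒≤ r<B) ⟩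
          k * B + B       ≤⟨ m≤m+n _ (p j) ⟩
          k * B + B + p j ∎
          where open ≤-Reasoning

      -- If job j does not fit after u, then neither does it in any packing
      -- that has reached the same machine, so the packing is on a later one.
      next-machine-lower : d j < r + p j → LowerFor S (k * B + B + p j) j
      next-machine-lower nofit {k′} {c} _ P fit with k <? k′
      ... | yes k<k′ = begin
        k * B + B + p j     ≡⟨ cong (_+ p j) (+-comm (k * B) B) ⟩
        suc k * B + p j     ≤⟨ +-monoˡ-≤ (p j) (*-monoˡ-≤ B k<k′) ⟩
        k′ * B + p j        ≤⟨ +-monoʳ-≤ (k′ * B) (m≤n+m (p j) c) ⟩
        k′ * B + (c + p j)  ∎
        where open ≤-Reasoning
      ... | no k≮k′ = ⊥-elim (<⇒≱ nofit (≤-trans (+-monoˡ-≤ (p j) r≤c) fit))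
        where
        r≤c : r ≤ c
        r≤c = +-cancelˡ-≤ (k * B) r c (begin
          k * B + r   ≡⟨ kB+r≡u ⟩
          u           ≤⟨ lower P ⟩
          k′ * B + c  ≤⟨ +-monoˡ-≤ c (*-monoˡ-≤ B (≮⇒≥ k≮k′)) ⟩
          k * B + c   ∎)
          where open ≤-Reasoning

      never-fits : d j < p j → ∀ v → LowerFor S v j
      never-fits nofit v {c = c} _ _ fit = ⊥-elim (<⇒≱ nofit (≤-trans (m≤n+m (p j) c) fit))

-- Natural numbers among the rationals

fromℕ-mkℚ : ∀ k → fromℕ k ≡ ℚ.mkℚ (ℤ.+ k) 0 (Coprime.sym (Coprime.1-coprimeTo k))
-- The quotient by 1 is normalised with a gcd that does not reduce for a variable `k`; the explicit
-- fraction exposes numerator and denominator to the integer lemmas.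
fromℕ-mkℚ k = ℚ.normalize-coprime (Coprime.sym (Coprime.1-coprimeTo k))

fromℕ-+ : ∀ a b → fromℕ (a + b) ≡ fromℕ a ℚ.+ fromℕ b
fromℕ-+ a b rewrite fromℕ-mkℚ a | fromℕ-mkℚ b =
  cong (λ k → k ℚ./ 1) (sym (cong₂ ℤ._+_ (ℤ.*-identityʳ (ℤ.+ a)) (ℤ.*-identityʳ (ℤ.+ b))))

fromℕ-mono-≤ : ∀ {a b} → a ≤ b → fromℕ a ℚ.≤ fromℕ b
fromℕ-mono-≤ {a} {b} a≤b rewrite fromℕ-mkℚ a | fromℕ-mkℚ b =
  ℚ.*≤* (ℤ.*-monoʳ-≤-nonNeg (ℤ.+ 1) (ℤ.+≤+ a≤b))

fromℕ-cancel-≤ : ∀ {a b} → fromℕ a ℚ.≤ fromℕ b → a ≤ b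
fromℕ-cancel-≤ {a} {b} le rewrite fromℕ-mkℚ a | fromℕ-mkℚ b with le
... | ℚ.*≤* le′ = ℤ.drop‿+≤+ (ℤ.*-cancelʳ-≤-pos _ _ (ℤ.+ 1) le′)

-- From packings to schedules

module _ {p d : Fin n → ℕ} where
  open Packings p d

  -- `ends≤` and `machine≤` are what the induction needs beyond a schedule: the first keeps a job
  -- started at `c` disjoint from its predecessors on machine `k`, the second shows that a newly
  -- opened machine is free.
  record Placement (S : Subset n) (k c : ℕ) : Set where
    field
      machine  : Fin n → ℕ
      offset   : Fin n → ℕ
      machine≤ : ∀ {j} → lookup S j ≡ true → machine j ≤ k
      on-time  : ∀ {j} → lookup S j ≡ true → offset j + p j ≤ d j
      ends≤    : ∀ {j} → lookup S j ≡ true → machine j ≡ k → offset j + p j ≤ c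
      disjoint : ∀ {i j} → lookup S i ≡ true → lookup S j ≡ true → i ≢ j → machine i ≡ machine j →
                 offset i + p i ≤ offset j ⊎ offset j + p j ≤ offset i

  placement : ∀ {S k c} → Packing S k c → Placement S k c
  placement empty = record
    { machine  = λ _ → 0
    ; offset   = λ _ → 0
    ; machine≤ = λ {j} j∈ → ⊥-elim (∈⊥-absurd j j∈)
    ; on-time  = λ {j} j∈ → ⊥-elim (∈⊥-absurd j j∈)
    ; ends≤    = λ {j} j∈ → ⊥-elim (∈⊥-absurd j j∈)
    ; disjoint = λ {j} j∈ → ⊥-elim (∈⊥-absurd j j∈)
    }
  placement (next P) = record
    { machine  = machine
    ; offset   = offset
    ; machine≤ = m≤n⇒m≤1+n ∘ machine≤
    ; on-time  = on-time
    ; ends≤    = λ j∈ eq → ⊥-elim (<-irrefl eq (s≤s (machine≤ j∈)))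
    ; disjoint = disjoint
    }
    where open Placement (placement P)
  placement {S} {k} (place {c = c} j j∈ P fit) = record
    { machine  = machine′
    ; offset   = offset′
    ; machine≤ = machine≤′
    ; on-time  = on-time′
    ; ends≤    = ends≤′
    ; disjoint = disjoint′
    }
    where
    open Placement (placement P)
    machine′ offset′ : Fin n → ℕ
    machine′ = updateAt machine j (λ _ → k)
    offset′  = updateAt offset j (λ _ → c)

    machine′-j : machine′ j ≡ k
    machine′-j = updateAt-updates j machine
    offset′-j : offset′ j ≡ c
    offset′-j = updateAt-updates j offset
    machine′-≢ : ∀ {i} → i ≢ j → machine′ i ≡ machine i
    machine′-≢ = updateAt-minimal _ j machine
    offset′-≢ : ∀ {i} → i ≢ j → offset′ i ≡ offset i
    offset′-≢ = updateAt-minimal _ j offset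

    machine≤′ : ∀ {i} → lookup S i ≡ true → machine′ i ≤ k
    machine≤′ {i} i∈ with i Fin.≟ j
    ... | yes refl = ≤-reflexive machine′-j
    ... | no i≢j rewrite machine′-≢ i≢j = machine≤ (∈-remove S i∈ i≢j)

    on-time′ : ∀ {i} → lookup S i ≡ true → offset′ i + p i ≤ d i
    on-time′ {i} i∈ with i Fin.≟ j
    ... | yes refl rewrite offset′-j = fit
    ... | no i≢j rewrite offset′-≢ i≢j = on-time (∈-remove S i∈ i≢j)

    ends≤′ : ∀ {i} → lookup S i ≡ true → machine′ i ≡ k → offset′ i + p i ≤ c + p j
    ends≤′ {i} i∈ eq with i Fin.≟ j
    ... | yes refl rewrite offset′-j = ≤-refl
    ... | no i≢j rewrite offset′-≢ i≢j | machine′-≢ i≢j =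
      ≤-trans (ends≤ (∈-remove S i∈ i≢j) eq) (m≤m+n c _)

    before-j : ∀ {i} → i ≢ j → lookup S i ≡ true → machine′ i ≡ machine′ j → offset′ i + p i ≤ offset′ j
    before-j i≢j i∈ eq rewrite offset′-≢ i≢j | machine′-≢ i≢j | offset′-j | machine′-j =
      ends≤ (∈-remove S i∈ i≢j) eq

    disjoint′ : ∀ {i l} → lookup S i ≡ true → lookup S l ≡ true → i ≢ l → machine′ i ≡ machine′ l →
                offset′ i + p i ≤ offset′ l ⊎ offset′ l + p l ≤ offset′ i
    disjoint′ {i} {l} i∈ l∈ i≢l eq with i Fin.≟ j | l Fin.≟ j
    ... | yes refl | yes refl = ⊥-elim (i≢l refl)
    ... | yes refl | no l≢j   = inj₂ (before-j l≢j l∈ (sym eq))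
    ... | no i≢j   | yes refl = inj₁ (before-j i≢j i∈ eq)
    ... | no i≢j   | no l≢j rewrite offset′-≢ i≢j | offset′-≢ l≢j | machine′-≢ i≢j | machine′-≢ l≢j =
      disjoint (∈-remove S i∈ i≢j) (∈-remove S l∈ l≢j) i≢l eq

module _ (I : Jobs n) where
  open Jobs I
  open Packings p d

  module FromPacking {S k c} (P : Packing S k c) (k<m : k < m) where
    open Placement (placement P)

    -- The late jobs go to machine 0, each into its own time slot after all the due dates.
    H : ℕ
    H = sum d + sum p

    machineℕ startℕ : Fin n → ℕ
    machineℕ j = if lookup S j then machine j else 0
    startℕ   j = if lookup S j then offset j else suc (toℕ j) * H

    machineℕ<m : ∀ j → machineℕ j < m
    machineℕ<m j with lookup S j in j∈
    ... | true  = ≤-<-trans (machine≤ j∈) k<m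
    ... | false = m≥1

    p≤H : ∀ j → p j ≤ H
    p≤H j = ≤-trans (≤sum p j) (m≤n+m _ (sum d))

    early-late : ∀ {i} (j : Fin n) → lookup S i ≡ true → offset i + p i ≤ suc (toℕ j) * H
    early-late {i} j i∈ = begin
      offset i + p i    ≤⟨ on-time i∈ ⟩
      d i               ≤⟨ ≤sum d i ⟩
      sum d             ≤⟨ m≤m+n _ _ ⟩
      H                 ≤⟨ m≤m+n H _ ⟩
      suc (toℕ j) * H   ∎
      where open ≤-Reasoning

    late-late : ∀ {i j : Fin n} → toℕ i < toℕ j → suc (toℕ i) * H + p i ≤ suc (toℕ j) * H
    late-late {i} {j} i<j = begin
      suc (toℕ i) * H + p i   ≤⟨ +-monoʳ-≤ (suc (toℕ i) * H) (p≤H i) ⟩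
      suc (toℕ i) * H + H     ≡⟨ +-comm _ H ⟩
      suc (suc (toℕ i)) * H   ≤⟨ *-monoˡ-≤ H (s≤s i<j) ⟩
      suc (toℕ j) * H         ∎
      where open ≤-Reasoning

    disjointℕ : ∀ i j → i ≢ j → machineℕ i ≡ machineℕ j →
                startℕ i + p i ≤ startℕ j ⊎ startℕ j + p j ≤ startℕ i
    disjointℕ i j i≢j eq with lookup S i in i∈ | lookup S j in j∈
    ... | true  | true  = disjoint i∈ j∈ i≢j eq
    ... | true  | false = inj₁ (early-late j i∈)
    ... | false | true  = inj₂ (early-late i j∈)
    ... | false | false with Fin.<-cmp i j
    ...   | tri< i<j _ _ = inj₁ (late-late i<j)
    ...   | tri≈ _ i≡j _ = ⊥-elim (i≢j i≡j)
    ...   | tri> _ _ j<i = inj₂ (late-late j<i)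

    begin-time : Fin n → ℚ
    begin-time j = fromℕ (startℕ j)

    not-both : ∀ i j t → startℕ i + p i ≤ startℕ j → InProcess I begin-time i t → ¬ InProcess I begin-time j t
    not-both i j t le (_ , t<Ci) (sj≤t , _) = ℚ.<-irrefl refl (ℚ.<-≤-trans t<Ci (begin
      fromℕ (startℕ i) ℚ.+ fromℕ (p i) ≡⟨ fromℕ-+ (startℕ i) (p i) ⟨
      fromℕ (startℕ i + p i)           ≤⟨ fromℕ-mono-≤ le ⟩
      fromℕ (startℕ j)                 ≤⟨ sj≤t ⟩
      t                                ∎))
      where open ℚ.≤-Reasoning

    schedule : Schedule I
    schedule = record
      { machine   = λ j → fromℕ< (machineℕ<m j)
      ; start     = begin-time
      ; start≥0   = λ j → fromℕ-mono-≤ {0} {startℕ j} z≤n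
      ; noOverlap = no-overlap
      }
      where
      no-overlap : ∀ i j → i ≢ j → fromℕ< (machineℕ<m i) ≡ fromℕ< (machineℕ<m j) →
                   ∀ t → ¬ (InProcess I begin-time i t × InProcess I begin-time j t)
      no-overlap i j i≢j eq t (in-i , in-j) =
        [ (λ le → not-both i j t le in-i in-j) , (λ le → not-both j i t le in-j in-i) ]′
          (disjointℕ i j i≢j (Fin.fromℕ<-injective _ _ (machineℕ<m i) (machineℕ<m j) eq))

    U≤1 : ∀ j → U I begin-time j ≤ 1
    U≤1 j = bit≤1 (does (fromℕ (d j) ℚ.<? completion I begin-time j))

    completion≤d : ∀ {j} → lookup S j ≡ true → completion I begin-time j ℚ.≤ fromℕ (d j)
    completion≤d {j} j∈ = subst (ℚ._≤ fromℕ (d j)) (fromℕ-+ (startℕ j) (p j)) (fromℕ-mono-≤ startℕ+p≤d)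
      where
      startℕ+p≤d : startℕ j + p j ≤ d j
      startℕ+p≤d rewrite j∈ = on-time j∈

    U≡0 : ∀ {j} → lookup S j ≡ true → U I begin-time j ≡ 0
    U≡0 {j} j∈ = cong bit
      (dec-false (fromℕ (d j) ℚ.<? completion I begin-time j) λ lt → ℚ.<-irrefl refl (ℚ.<-≤-trans lt (completion≤d j∈)))

    -- Equality can fail: a job of length 0 outside S may be on time by accident, for instance when
    -- `H` is 0.
    tardyWeight≤ : tardyWeight I schedule ≤ outsideSum w S
    tardyWeight≤ = sum-mono-≤ λ j → bound (lookup S j) (w j) {U I begin-time j} U≡0 (U≤1 j)
      where
      bound : ∀ b x {u} → (b ≡ true → u ≡ 0) → u ≤ 1 → x * u ≤ (if b then 0 else x)
      bound true  x u≡0 _   = ≤-reflexive (trans (cong (x *_) (u≡0 refl)) (*-zeroʳ x))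
      bound false x {u} _ u≤1 = subst (x * u ≤_) (*-identityʳ x) (*-monoʳ-≤ x u≤1)

-- From schedules to packings

argmax : ∀ {n} {Q : Fin n → Set} → (∀ j → Dec (Q j)) → (f : Fin n → ℚ) →
         (∀ j → ¬ Q j) ⊎ (∃[ j ] Q j × (∀ i → Q i → f i ℚ.≤ f j))
argmax {zero}  Q? f = inj₁ λ ()
argmax {suc n} Q? f with Q? zero | argmax (Q? ∘ suc) (f ∘ suc)
... | no ¬q | inj₁ none = inj₁ λ { zero → ¬q ; (suc j) → none j }
... | yes q | inj₁ none = inj₂ (zero , q , λ { zero _ → ℚ.≤-refl ; (suc j) qj → ⊥-elim (none j qj) })
... | no ¬q | inj₂ (j , qj , max) = inj₂ (suc j , qj , λ { zero q → ⊥-elim (¬q q) ; (suc i) → max i })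
... | yes q | inj₂ (j , qj , max) with ℚ.≤-total (f zero) (f (suc j))
...   | inj₁ f0≤ = inj₂ (suc j , qj , λ { zero _ → f0≤ ; (suc i) → max i })
...   | inj₂ ≤f0 = inj₂ (zero , q , λ { zero _ → ℚ.≤-refl ; (suc i) qi → ℚ.≤-trans (max i qi) ≤f0 })

module FromSchedule {n} (I : Jobs n) (σ : Schedule I) where
  open Jobs I
  open Packings p d
  open Schedule σ

  C : Fin n → ℚ
  C = completion I start

  start≤C : ∀ j → start j ℚ.≤ C j
  start≤C j = subst (ℚ._≤ C j) (ℚ.+-identityʳ (start j)) (ℚ.+-monoʳ-≤ (start j) (fromℕ-mono-≤ {0} {p j} z≤n))

  0<p⇒start<C : ∀ j → p j ≢ 0 → start j ℚ.< C j
  0<p⇒start<C j pj≢0 = subst (ℚ._< C j) (ℚ.+-identityʳ (start j)) (ℚ.+-monoʳ-< (start j)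
    (ℚ.≰⇒> λ le → pj≢0 (n≤0⇒n≡0 (fromℕ-cancel-≤ {p j} {0} le))))

  -- If `j` started before `i` ended, the later of the two starting times would lie in both
  -- intervals. Positive lengths ensure that a job is in process at its own starting time.
  ends-before : ∀ {i j} → i ≢ j → machine i ≡ machine j → p i ≢ 0 → p j ≢ 0 → C i ℚ.≤ C j → C i ℚ.≤ start j
  ends-before {i} {j} i≢j same pi≢0 pj≢0 Ci≤Cj = ℚ.≮⇒≥ λ sj<Ci →
    [ (λ si≤sj → noOverlap i j i≢j same (start j)
        ((si≤sj , sj<Ci) , (ℚ.≤-refl , 0<p⇒start<C j pj≢0)))
    , (λ sj≤si → noOverlap i j i≢j same (start i)
        ((ℚ.≤-refl , 0<p⇒start<C i pi≢0) , (sj≤si , ℚ.<-≤-trans (0<p⇒start<C i pi≢0) Ci≤Cj)))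
    ]′ (ℚ.≤-total (start i) (start j))

  OnMachine : Subset n → ℕ → Fin n → Set
  OnMachine S k j = lookup S j ≡ true × toℕ (machine j) ≡ k

  onMachine? : ∀ S k j → Dec (OnMachine S k j)
  onMachine? S k j = (lookup S j Bool.≟ true) ×-dec (toℕ (machine j) ≟ k)

  workload : Subset n → ℕ → ℕ
  workload S k = sum (λ j → if does (onMachine? S k j) then p j else 0)

  workload-remove : ∀ S k j → OnMachine S k j → workload S k ≡ workload (S [ j ]≔ false) k + p j
  workload-remove S k j on = trans (sum-isolate _ _ j agree absent)
    (cong (λ b → workload (S [ j ]≔ false) k + (if b then p j else 0)) (dec-true (onMachine? S k j) on))
    where
    agree : ∀ i → i ≢ j → (if does (onMachine? S k i) then p i else 0) ≡
                          (if does (onMachine? (S [ j ]≔ false) k i) then p i else 0)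
    agree i i≢j rewrite lookup∘update′ i≢j S false = refl
    absent : (if does (onMachine? (S [ j ]≔ false) k j) then p j else 0) ≡ 0
    absent rewrite lookup∘update j S false = refl

  workload-zero : ∀ S k → (∀ j → ¬ OnMachine S k j) → workload S k ≡ 0
  workload-zero S k none = sum-zero _ λ j →
    cong (λ b → if b then p j else 0) (dec-false (onMachine? S k j) (none j))

  -- Jobs of length 0 may be processed inside the intervals of others; they do
  -- not count for the workload, so τ need not bound their completion times.
  EndsBy : ℚ → Subset n → ℕ → Set
  EndsBy τ S k = ∀ j → OnMachine S k j → p j ≢ 0 → C j ℚ.≤ τ

  -- Remove the job `j` that completes last. If `p j` is positive, the other jobs of positive length
  -- end by `start j`, so their workload is at most `start j`, and adding `p j` gives at most `C j`.
  -- If `p j` is 0, the workload does not change. `fuel` makes the descent along `code S`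
  -- structural.
  workload-bound : ∀ S k {τ} fuel → code S < fuel → 0ℚ ℚ.≤ τ → EndsBy τ S k → fromℕ (workload S k) ℚ.≤ τ
  workload-bound S k {τ} (suc fuel) (s≤s code≤) 0≤τ ends =
    [ (λ none → subst (λ l → fromℕ l ℚ.≤ τ) (sym (workload-zero S k none)) 0≤τ)
    , (λ (j , on , max) → last j on max (p j ≟ 0))
    ]′ (argmax (onMachine? S k) C)
    where
    last : ∀ j → OnMachine S k j → (∀ i → OnMachine S k i → C i ℚ.≤ C j) → Dec (p j ≡ 0) →
           fromℕ (workload S k) ℚ.≤ τ
    last j on max p≟0 = subst (λ l → fromℕ l ℚ.≤ τ) (sym (workload-remove S k j on)) (bound p≟0)
      where
      S′ = S [ j ]≔ false
      rest : ∀ {υ} → 0ℚ ℚ.≤ υ → EndsBy υ S′ k → fromℕ (workload S′ k) ℚ.≤ υ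
      rest = workload-bound S′ k fuel (<-≤-trans (code-remove-< S j (proj₁ on)) code≤)
      bound : Dec (p j ≡ 0) → fromℕ (workload S′ k + p j) ℚ.≤ τ
      bound (yes pj≡0) = subst (λ l → fromℕ l ℚ.≤ τ)
        (sym (trans (cong (workload S′ k +_) pj≡0) (+-identityʳ _)))
        (rest 0≤τ λ i (i∈ , mi) → ends i (proj₂ (remove-∈ S i∈) , mi))
      bound (no pj≢0) = subst (ℚ._≤ τ) (sym (fromℕ-+ (workload S′ k) (p j)))
        (ℚ.≤-trans (ℚ.+-monoˡ-≤ (fromℕ (p j)) rest≤start) (ends j on pj≢0))
        where
        rest≤start : fromℕ (workload S′ k) ℚ.≤ start j
        rest≤start = rest (start≥0 j) λ i (i∈ , mi) pi≢0 → let i≢j , i∈S = remove-∈ S i∈ in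
          ends-before i≢j (Fin.toℕ-injective (trans mi (sym (proj₂ on)))) pi≢0 pj≢0 (max i (i∈S , mi))

  OnTime : Subset n → Set
  OnTime S = ∀ j → lookup S j ≡ true → C j ℚ.≤ fromℕ (d j)

  -- The last job `j` of machine `k`, in the order of completion times and with jobs of length 0
  -- included, is made to end at the workload. By `workload-bound` with τ = `C j` this is no later
  -- than in the schedule, hence on time. Once no job of S is left on the machine, `next` leads back
  -- to the machine before it.
  pack : ∀ S k fuel → code S < fuel → OnTime S → (∀ j → lookup S j ≡ true → toℕ (machine j) ≤ k) →
         Packing S k (workload S k)
  pack S k (suc fuel) (s≤s code≤) on-time machine≤ =
    [ (λ none → subst (Packing S k) (sym (workload-zero S k none)) (idle k machine≤ none))
    , (λ (j , on , max) → last j on max)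
    ]′ (argmax (onMachine? S k) C)
    where
    idle : ∀ k → (∀ j → lookup S j ≡ true → toℕ (machine j) ≤ k) → (∀ j → ¬ OnMachine S k j) →
           Packing S k 0
    idle zero machine≤ none = subst (λ S → Packing S 0 0)
      (sym (lookup⇒≡⊥ S (λ j j∈ → none j (j∈ , n≤0⇒n≡0 (machine≤ j j∈))))) empty
    idle (suc k) machine≤ none = next (pack S k (suc fuel) (s≤s code≤) on-time λ j j∈ →
      s≤s⁻¹ (≤∧≢⇒< (machine≤ j j∈) λ eq → none j (j∈ , eq)))
    last : ∀ j → OnMachine S k j → (∀ i → OnMachine S k i → C i ℚ.≤ C j) → Packing S k (workload S k)
    last j on max = subst (Packing S k) (sym (workload-remove S k j on))
      (place j (proj₁ on)
        (pack (S [ j ]≔ false) k fuel (<-≤-trans (code-remove-< S j (proj₁ on)) code≤)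
          (λ i → on-time i ∘ proj₂ ∘ remove-∈ S) (λ i → machine≤ i ∘ proj₂ ∘ remove-∈ S))
        (subst (_≤ d j) (workload-remove S k j on) (fromℕ-cancel-≤ (ℚ.≤-trans
          (workload-bound S k (suc fuel) (s≤s code≤) (ℚ.≤-trans (start≥0 j) (start≤C j)) λ i on-i _ → max i on-i)
          (on-time j (proj₁ on))))))

  early : Subset n
  early = tabulate λ j → does (¬? (fromℕ (d j) ℚ.<? C j))

  tardyWeight-early : outsideSum w early ≡ tardyWeight I σ
  tardyWeight-early = sum-cong-≗ eq
    where
    late? : ∀ j → Dec (fromℕ (d j) ℚ.< C j)
    late? j = fromℕ (d j) ℚ.<? C j
    weigh : ∀ b x → (if not b then 0 else x) ≡ x * bit b
    weigh true  x = sym (*-identityʳ x)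
    weigh false x = sym (*-zeroʳ x)
    eq : ∀ j → (if lookup early j then 0 else w j) ≡ w j * U I start j
    eq j = trans (cong (λ b → if b then 0 else w j) (lookup∘tabulate (does ∘ ¬? ∘ late?) j)) (weigh (does (late? j)) (w j))

  early-onTime : OnTime early
  early-onTime j j∈ = ℚ.≮⇒≥ (does⁻ (¬? (fromℕ (d j) ℚ.<? C j))
    (trans (sym (lookup∘tabulate (λ j → does (¬? (fromℕ (d j) ℚ.<? C j))) j)) j∈))
    where
    does⁻ : ∀ {A : Set} (a? : Dec A) → does a? ≡ true → A
    does⁻ (yes a) _ = a

  packing-early : ∃[ k ] ∃[ c ] (k < m × Packing early k c)
  packing-early = pred m , _ , ≤-reflexive (suc-pred m ⦃ >-nonZero m≥1 ⦄) ,
    pack early (pred m) _ (n<1+n _) early-onTime λ j _ → <⇒≤pred (Fin.toℕ<n (machine j))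

-- A program logic with step counts

get : List ℕ → ℕ → ℕ
get xs i = fromMaybe 0 (xs ‼ i)

upd : List ℕ → ℕ → ℕ → List ℕ
upd []       zero    v = v ∷ []
upd []       (suc i) v = 0 ∷ upd [] i v
upd (x ∷ xs) zero    v = v ∷ xs
upd (x ∷ xs) (suc i) v = x ∷ upd xs i v

get-upd : ∀ xs i v j → get (upd xs i v) j ≡ (get xs [ i ≔ v ]) j
get-upd []       zero    v zero    = refl
get-upd []       zero    v (suc j) = refl
get-upd []       (suc i) v zero    = refl
get-upd []       (suc i) v (suc j) = get-upd [] i v j
get-upd (x ∷ xs) zero    v zero    = refl
get-upd (x ∷ xs) zero    v (suc j) = refl
get-upd (x ∷ xs) (suc i) v zero    = refl
get-upd (x ∷ xs) (suc i) v (suc j) = get-upd xs i v j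

-- The register file is kept as a list, so that looking up and updating a
-- register whose number is a literal computes.
module Hoare (W : ℕ) (P : Program) (Q : ℕ → Set) where

  -- Register files are functions, so agreement with `xs` is pointwise; claiming the result for
  -- every such `r` spares function extensionality. As `b` is only an upper bound, branches of
  -- different lengths can be levelled with `pad`.
  record Halts (b pc : ℕ) (xs : List ℕ) (μ : ℕ → ℕ) : Set where
    field
      run : ∀ r → (∀ i → r i ≡ get xs i) →
            ∃[ v ] ∃[ t ] (Run W P ⟨ pc , r , μ ⟩ v t × Q v × t ≤ b)

  open Halts

  weaken : ∀ {b b′ pc xs μ} → b ≤ b′ → Halts b pc xs μ → Halts b′ pc xs μ
  weaken b≤b′ h .run r r≡ with run h r r≡
  ... | v , t , ρ , q , t≤b = v , t , ρ , q , ≤-trans t≤b b≤b′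

  pad : ∀ k {b pc xs μ} → Halts b pc xs μ → Halts (k + b) pc xs μ
  pad k = weaken (m≤n+m _ k)

  private
    truncate-id : ∀ {x} → x < 2 ^ W → truncate W x ≡ x
    truncate-id = m<n⇒m%n≡m ⦃ m^n≢0 2 W ⦄

    get-≔ : ∀ {r xs d x y} → (∀ i → r i ≡ get xs i) → x ≡ y → ∀ i → (r [ d ≔ x ]) i ≡ get (upd xs d y) i
    get-≔ {xs = xs} {d} {x} r≡ refl i = trans (cong (if does (i ≟ d) then x else_) (r≡ i)) (sym (get-upd xs d x i))

    step-to : ∀ {i pc pc′ r r′ μ μ′ xs b} → P ‼ pc ≡ just i → exec W i ⟨ pc , r , μ ⟩ ≡ just ⟨ pc′ , r′ , μ′ ⟩ →
            (∀ i → r′ i ≡ get xs i) → Halts b pc′ xs μ′ →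
            ∃[ v ] ∃[ t ] (Run W P ⟨ pc , r , μ ⟩ v t × Q v × t ≤ suc b)
    step-to fetch ex r′≡ h with run h _ r′≡
    ... | v , t , ρ , q , t≤b = v , suc t , step fetch ex ρ , q , s≤s t≤b

  -- Straight-line code is executed by computation rather than rule by rule:
  -- the intermediate register files do not occur in the proof terms.
  advance : (ℕ → ℕ) → Maybe Instr → List ℕ → List ℕ
  advance μ (just (const d k))     xs = upd xs d k
  advance μ (just (arith o d a b)) xs = upd xs d (evalOp o (get xs a) (get xs b))
  advance μ (just (load d a))      xs = upd xs d (μ (get xs a))
  advance μ _                      xs = xs

  after : (k pc : ℕ) → (ℕ → ℕ) → List ℕ → List ℕ
  after zero    pc μ xs = xs
  after (suc k) pc μ xs = after k (suc pc) μ (advance μ (P ‼ pc) xs)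

  -- The condition under which `truncate` does nothing; a load is not truncated. `Empty` keeps jumps
  -- and stores out of straight-line code.
  Fit : Maybe Instr → List ℕ → Set → Set
  Fit (just (const d k))     xs R = k < 2 ^ W × R
  Fit (just (arith o d a b)) xs R = evalOp o (get xs a) (get xs b) < 2 ^ W × R
  Fit (just (load d a))      xs R = R
  Fit _                      xs R = Empty

  Fits : (k pc : ℕ) → (ℕ → ℕ) → List ℕ → Set
  Fits zero    pc μ xs = ⊤
  Fits (suc k) pc μ xs = Fit (P ‼ pc) xs (Fits k (suc pc) μ (advance μ (P ‼ pc) xs))

  straight : ∀ k {b pc xs μ} → Fits k pc μ xs → Halts b (k + pc) (after k pc μ xs) μ → Halts (k + b) pc xs μ
  straight zero    _    h = h
  straight (suc k) {b} {pc} {xs} {μ} fits h = one (P ‼ pc) refl fits λ fits →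
    straight k fits (subst (λ l → Halts b l (after (suc k) pc μ xs) μ) (sym (+-suc k pc)) h)
    where
    one : ∀ mi {R b} → P ‼ pc ≡ mi → Fit mi xs R →
          (R → Halts b (suc pc) (advance μ mi xs) μ) → Halts (suc b) pc xs μ
    one (just (const d x)) fetch (x< , rest) h .run r r≡ =
      step-to fetch refl (get-≔ {xs = xs} r≡ (truncate-id x<)) (h rest)
    one (just (arith o d a b)) fetch (x< , rest) h .run r r≡ =
      step-to fetch refl (get-≔ {xs = xs} r≡
        (trans (cong (truncate W) (cong₂ (evalOp o) (r≡ a) (r≡ b))) (truncate-id x<))) (h rest)
    one (just (load d a)) fetch rest h .run r r≡ =
      step-to fetch refl (get-≔ {xs = xs} r≡ (cong μ (r≡ a))) (h rest)

  module _ {b pc : ℕ} {xs : List ℕ} {μ : ℕ → ℕ} where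

    halt! : P ‼ pc ≡ just halt → Q (get xs 0) → Halts (suc b) pc xs μ
    halt! fetch q .run r r≡ = r 0 , 1 , stop fetch , subst Q (sym (r≡ 0)) q , s≤s z≤n

    store! : ∀ {a s} → P ‼ pc ≡ just (store a s) →
             Halts b (suc pc) xs (μ [ get xs a ≔ get xs s ]) → Halts (suc b) pc xs μ
    store! {a} {s} fetch h .run r r≡ = step-to fetch
      (cong₂ (λ x y → just ⟨ suc pc , r , μ [ x ≔ y ] ⟩) (r≡ a) (r≡ s)) r≡ h

    jump! : ∀ {l} → P ‼ pc ≡ just (jump l) → Halts b l xs μ → Halts (suc b) pc xs μ
    jump! fetch h .run r r≡ = step-to fetch refl r≡ h

    private
      goto : ∀ {l r} {A : Set} (a? : Dec A) x → does a? ≡ x →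
             just ⟨ (if does a? then l else suc pc) , r , μ ⟩ ≡ just ⟨ (if x then l else suc pc) , r , μ ⟩
      goto {l} {r} a? x eq = cong (λ x → just ⟨ (if x then l else suc pc) , r , μ ⟩) eq

    <-taken : ∀ {s₁ s₂ l} → P ‼ pc ≡ just (jumpIf< s₁ s₂ l) → get xs s₁ < get xs s₂ →
              Halts b l xs μ → Halts (suc b) pc xs μ
    <-taken {s₁} {s₂} fetch lt h .run r r≡ = step-to fetch
      (goto (r s₁ <? r s₂) true (dec-true (r s₁ <? r s₂) (subst₂ _<_ (sym (r≡ s₁)) (sym (r≡ s₂)) lt))) r≡ h

    <-skipped : ∀ {s₁ s₂ l} → P ‼ pc ≡ just (jumpIf< s₁ s₂ l) → ¬ (get xs s₁ < get xs s₂) →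
                Halts b (suc pc) xs μ → Halts (suc b) pc xs μ
    <-skipped {s₁} {s₂} fetch ≮ h .run r r≡ = step-to fetch
      (goto (r s₁ <? r s₂) false (dec-false (r s₁ <? r s₂) (λ lt → ≮ (subst₂ _<_ (r≡ s₁) (r≡ s₂) lt)))) r≡ h

    ≡-taken : ∀ {s₁ s₂ l} → P ‼ pc ≡ just (jumpIf≡ s₁ s₂ l) → get xs s₁ ≡ get xs s₂ →
              Halts b l xs μ → Halts (suc b) pc xs μ
    ≡-taken {s₁} {s₂} fetch eq h .run r r≡ = step-to fetch
      (goto (r s₁ ≟ r s₂) true (dec-true (r s₁ ≟ r s₂) (trans (r≡ s₁) (trans eq (sym (r≡ s₂)))))) r≡ h

    ≡-skipped : ∀ {s₁ s₂ l} → P ‼ pc ≡ just (jumpIf≡ s₁ s₂ l) → get xs s₁ ≢ get xs s₂ →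
                Halts b (suc pc) xs μ → Halts (suc b) pc xs μ
    ≡-skipped {s₁} {s₂} fetch ≢ h .run r r≡ = step-to fetch
      (goto (r s₁ ≟ r s₂) false (dec-false (r s₁ ≟ r s₂) (λ eq → ≢ (trans (sym (r≡ s₁)) (trans eq (r≡ s₂)))))) r≡ h

-- The program and its states

-- Registers: 0 answer, 1 pointer into the jobs, 2 address of the table,
-- 3 B, 4 2ⁿ, 5 cap, 6 subset s, 7 table entry of s, 8 weight outside s,
-- 9 remaining bits of s, 10 power of two of the current job,
-- 11–13 the constants 1, 2, 0, from 14 on temporaries (14, 15, 16 hold p, w, d).
program : Program
program =
    const 11 1             -- 0
  ∷ const 12 2
  ∷ const 14 3
  ∷ load 15 13
  ∷ arith mul 2 14 15
  ∷ arith add 2 2 12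
  ∷ load 5 11
  ∷ const 3 1
  ∷ const 4 1
  ∷ const 1 2
  ∷ jumpIf≡ 1 2 20         -- 10: sums over all jobs
  ∷ arith add 1 11 1
  ∷ load 14 1
  ∷ arith add 0 0 14
  ∷ arith add 1 11 1
  ∷ load 14 1
  ∷ arith add 3 3 14
  ∷ arith add 1 11 1
  ∷ arith add 4 4 4
  ∷ jump 10
  ∷ arith mul 5 5 3        -- 20
  ∷ const 6 1
  ∷ jumpIf< 6 4 24         -- 22: loop over the subsets
  ∷ halt
  ∷ arith add 7 13 5
  ∷ const 8 0
  ∷ arith add 9 13 6
  ∷ const 10 1
  ∷ const 1 2
  ∷ jumpIf≡ 1 2 61         -- 29: loop over the jobs
  ∷ load 14 1
  ∷ arith add 1 11 1
  ∷ load 15 1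
  ∷ arith add 1 11 1
  ∷ load 16 1
  ∷ arith add 1 11 1
  ∷ arith div 17 9 12
  ∷ arith add 18 17 17
  ∷ arith sub 18 9 18
  ∷ arith add 9 13 17
  ∷ arith sub 19 6 10
  ∷ arith add 19 2 19
  ∷ arith add 10 10 10
  ∷ jumpIf≡ 18 13 59
  ∷ load 19 19             -- 44: the job is in s
  ∷ arith div 17 19 3
  ∷ arith mul 17 17 3
  ∷ arith sub 20 19 17
  ∷ arith add 20 20 14
  ∷ jumpIf< 16 20 52
  ∷ arith add 19 19 14     -- 50: it fits on the current machine
  ∷ jump 55
  ∷ jumpIf< 16 14 29       -- 52: it needs a new machine
  ∷ arith add 19 17 3
  ∷ arith add 19 19 14
  ∷ jumpIf< 19 7 57        -- 55
  ∷ jump 29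
  ∷ arith add 7 13 19
  ∷ jump 29
  ∷ arith add 8 8 15       -- 59: the job is not in s
  ∷ jump 29
  ∷ arith add 14 2 6       -- 61: all jobs done
  ∷ store 14 7
  ∷ arith add 6 11 6
  ∷ jumpIf< 7 5 66
  ∷ jump 22
  ∷ jumpIf< 8 0 68
  ∷ jump 22
  ∷ arith add 0 13 8
  ∷ jump 22
  ∷ []

-- The fourteen named registers and seven temporaries are the 21 registers that the program touches.
-- Register 13 holds 0, so adding it to another register copies that register.
file : (ans ptr base B N cap s best out q pow : ℕ) → Vec ℕ 7 → List ℕ
file ans ptr base B N cap s best out q pow temps =
  ans ∷ ptr ∷ base ∷ B ∷ N ∷ cap ∷ s ∷ best ∷ out ∷ q ∷ pow ∷ 1 ∷ 2 ∷ 0 ∷ toList temps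

JobsAt : ∀ {k} → (ℕ → ℕ) → ℕ → (p w d : Fin k → ℕ) → Set
JobsAt {zero}  μ a p w d = ⊤
JobsAt {suc k} μ a p w d =
  μ a ≡ p zero × μ (1 + a) ≡ w zero × μ (2 + a) ≡ d zero × JobsAt μ (3 + a) (p ∘ suc) (w ∘ suc) (d ∘ suc)

next-job : ∀ {a b} k → a + 3 * suc k ≡ b → 3 + a + 3 * k ≡ b
next-job {a} k eq = trans (cong (_+ 3 * k) (+-comm 3 a)) (trans (+-assoc a 3 _) (trans (cong (a +_) (sym (*-suc 3 k))) eq))

job-address : ∀ {a b} k → a + 3 * suc k ≡ b → 3 + a ≤ b
job-address {a} k eq = subst (3 + a ≤_) (next-job k eq) (m≤m+n _ _)

jobsAt-agree : ∀ {k μ μ′ a b} {p w d : Fin k → ℕ} → a + 3 * k ≡ b → (∀ x → x < b → μ′ x ≡ μ x) →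
               JobsAt μ a p w d → JobsAt μ′ a p w d
jobsAt-agree {zero}  eq agree _ = tt
jobsAt-agree {suc k} {a = a} eq agree (pa , wa , da , rest) =
  trans (agree _ (m+n≤o⇒n≤o 2 le)) pa , trans (agree _ (m+n≤o⇒n≤o 1 le)) wa , trans (agree _ le) da ,
  jobsAt-agree (next-job k eq) agree rest
  where le = job-address k eq

odd-digit : ∀ b {n} {S : Subset n} {q} → q ≡ code (b ∷ S) → q ∸ (q / 2 + q / 2) ≡ bit b
odd-digit b {S = S} refl rewrite code/2 b S = trans
  (cong (λ x → bit b + 2 * code S ∸ (code S + x)) (sym (+-identityʳ (code S)))) (m+n∸n≡m (bit b) (2 * code S))

outsideSum≤sum : ∀ {n} (f : Fin n → ℕ) S → outsideSum f S ≤ sum f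
outsideSum≤sum f S = sum-mono-≤ {f = λ j → if lookup S j then 0 else f j} bound
  where
  bound : ∀ j → (if lookup S j then 0 else f j) ≤ f j
  bound j with lookup S j
  ... | true  = z≤n
  ... | false = ≤-refl

≔-here : ∀ (f : ℕ → ℕ) i {v} → (f [ i ≔ v ]) i ≡ v
≔-here f i {v} = cong (λ b → if b then v else f i) (dec-true (i ≟ i) refl)

≔-other : ∀ (f : ℕ → ℕ) {i v j} → j ≢ i → (f [ i ≔ v ]) j ≡ f j
≔-other f {i} {v} {j} j≢i = cong (λ b → if b then v else f j) (dec-false (j ≟ i) j≢i)

-- Correctness and running time of the program

-- The two loops over the jobs take at most 10 and 27 steps per job.
time : ℕ → ℕ
time n = 15 + n * 10 + 2 ^ n * (14 + n * 27)

-- X bounds the quantities read off the input; the largest numbers computed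
-- are the candidates k B + B + p j ≤ cap + B + p j ≤ X² + 2 X.
module Correctness
  {n : ℕ} (I : Jobs n) (W X : ℕ) (Q : ℕ → Set)
  (fits : ∀ {x} → x ≤ X * X + (X + X) → x < 2 ^ W)
  (base≤X : 3 * n + 2 ≤ X) (2^n≤X : 2 ^ n ≤ X) (m≤X : Jobs.m I ≤ X)
  (p≤X : ∀ j → Jobs.p I j ≤ X) (Σw≤X : sum (Jobs.w I) ≤ X) (B≤X : suc (sum (Jobs.d I)) ≤ X)
  where

  open Jobs I
  open Packings p d
  open Hoare W program Q
  -- The sum of the due dates bounds each of them, and it is computed without comparisons while the
  -- input is scanned.
  open Table (sum d) m (≤sum d)

  base N : ℕ
  base = 3 * n + 2
  N    = 2 ^ n

  cap≤X² : cap ≤ X * X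
  cap≤X² = *-mono-≤ m≤X B≤X

  fits₁ : ∀ {x} → x ≤ X → x < 2 ^ W
  fits₁ x≤X = fits (≤-trans x≤X (≤-trans (m≤m+n X X) (m≤n+m _ (X * X))))

  fits₂ : ∀ {x y} → x ≤ X → y ≤ X → x + y < 2 ^ W
  fits₂ x≤X y≤X = fits (≤-trans (+-mono-≤ x≤X y≤X) (m≤n+m _ (X * X)))

  fits₃ : ∀ {x y} → x ≤ X * X → y ≤ X + X → x + y < 2 ^ W
  fits₃ x≤ y≤ = fits (+-mono-≤ x≤ y≤)

  fits-cap : ∀ {x} → x ≤ cap → x < 2 ^ W
  fits-cap x≤ = fits (≤-trans x≤ (≤-trans cap≤X² (m≤m+n _ _)))

  1≤X : 1 ≤ X
  1≤X = ≤-trans (s≤s z≤n) B≤X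

  2≤X : 2 ≤ X
  2≤X = ≤-trans (m≤n+m 2 (3 * n)) base≤X

  -- The accumulators `ans`, `D` and `N` are general so that the induction can run over the jobs
  -- still unread; register 3 starts at 1 in order to end as `B`. `done` takes equations, so the
  -- final values may keep the form in which the loop produces them.
  setup : ∀ {k b μ s best out q pow t} {p : Fin k → ℕ} (w d : Fin k → ℕ) {ptr ans D N ts} → JobsAt μ ptr p w d →
    ptr + 3 * k ≡ base → ans + sum w ≤ X → suc D + sum d ≤ X → N * 2 ^ k ≤ X →
    (∀ {ptr′ ans′ D′ N′ t} → ptr′ ≡ base → ans′ ≡ ans + sum w → D′ ≡ D + sum d → N′ ≡ N * 2 ^ k →
      Halts b 20 (file ans′ ptr′ base (suc D′) N′ m s best out q pow (t ∷ ts)) μ) →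
    Halts (k * 10 + suc b) 10 (file ans ptr base (suc D) N m s best out q pow (t ∷ ts)) μ
  setup {zero} w d {ptr} {ans} {D} {N} _ end _ _ _ done =
    ≡-taken refl ptr≡ (done ptr≡ (sym (+-identityʳ ans)) (sym (+-identityʳ D)) (sym (*-identityʳ N)))
    where ptr≡ = trans (sym (+-identityʳ ptr)) end
  setup {suc k} {μ = μ} w d {ptr} {ans} {D} {N} (_ , wa , da , rest) end ans≤ D≤ N≤ done =
    ≡-skipped refl (<⇒≢ (m+n≤o⇒n≤o 2 address)) $
    straight 8
      ( fits₁ (≤-trans (m+n≤o⇒n≤o 2 address) base≤X)
      , fits₁ (≤-trans (m≤m+n _ _) ans′≤)
      , fits₁ (≤-trans (m+n≤o⇒n≤o 1 address) base≤X)
      , fits₁ (≤-trans (m≤m+n _ _) D′≤)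
      , fits₁ (≤-trans address base≤X)
      , fits₁ (≤-trans (m≤m*n (N + N) (2 ^ k) ⦃ m^n≢0 2 k ⦄) N′≤)
      , tt) $
    jump! refl $
    setup (w ∘ suc) (d ∘ suc) rest (next-job k end) ans′≤ D′≤ N′≤
      λ ptr≡ ans≡ D≡ N≡ → done ptr≡ (trans ans≡ ans′≡) (trans D≡ D′≡) (trans N≡ N′≡)
    where
    address = job-address k end
    ans′≡ : ans + μ (1 + ptr) + sum (w ∘ suc) ≡ ans + sum w
    ans′≡ = trans (+-assoc ans _ _) (cong (λ x → ans + (x + sum (w ∘ suc))) wa)
    D′≡ : D + μ (2 + ptr) + sum (d ∘ suc) ≡ D + sum d
    D′≡ = trans (+-assoc D _ _) (cong (λ x → D + (x + sum (d ∘ suc))) da)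
    N′≡ : (N + N) * 2 ^ k ≡ N * 2 ^ suc k
    N′≡ = trans (cong (_* 2 ^ k) (trans (cong (N +_) (sym (+-identityʳ N))) (*-comm 2 N))) (*-assoc N 2 _)
    ans′≤ = subst (_≤ X) (sym ans′≡) ans≤
    D′≤ = subst (_≤ X) (cong suc (sym D′≡)) D≤
    N′≤ = subst (_≤ X) (sym N′≡) N≤

  Feasible : Subset n → Set
  Feasible S = ∃[ k ] ∃[ c ] (k < m × Packing S k c)

  feasible⇒<cap : ∀ {S v} → Optimal S v → Feasible S → v < cap
  feasible⇒<cap {v = v} opt (k , c , k<m , P) = begin-strict
    v           ≤⟨ Optimal.lower opt P ⟩
    k * B + c   <⟨ +-monoʳ-< (k * B) (s≤s (load≤ (≤sum d) P)) ⟩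
    k * B + B   ≡⟨ +-comm (k * B) B ⟩
    suc k * B   ≤⟨ *-monoˡ-≤ B k<m ⟩
    cap         ∎
    where open ≤-Reasoning

  <cap⇒feasible : ∀ {S v} → Optimal S v → v < cap → Feasible S
  <cap⇒feasible opt v<cap with Optimal.attained opt v<cap
  ... | k , c , P , _ , refl = k , c , *-cancelʳ-< B k m (≤-<-trans (m≤m+n _ c) v<cap) , P

  module Subsets (S : Subset n) (μ : ℕ → ℕ) (ans : ℕ)
    (table : ∀ S′ → code S′ < code S → Optimal S′ (μ (base + code S′))) where

    st : (ptr best out q pow : ℕ) → Vec ℕ 7 → List ℕ
    st ptr best out q pow = file ans ptr base B N cap (code S) best out q pow

    -- The common exit of all branches of the loop body: whichever candidate was tried, the entry
    -- has not grown, is still attained and now accounts for `j`.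
    Continue : (b ptr out q pow best : ℕ) (j : Fin n) → Set
    Continue b ptr out q pow best j =
      ∀ {best′ ts} → best′ ≤ best → Attains S best′ → LowerFor S best′ j →
      Halts b 29 (st ptr best′ out q pow ts) μ

    -- A candidate `x` above `cap` does not satisfy `Attains`, hence the proviso. It is stored only
    -- if it is below `best`, which is at most `cap`.
    relax : ∀ {b ptr best out q pow p w d e f x g j} →
      Attains S best → (x ≤ cap → Attains S x) → LowerFor S x j →
      Continue b ptr out q pow best j →
      Halts (3 + b) 55 (st ptr best out q pow (p ∷ w ∷ d ∷ e ∷ f ∷ x ∷ g ∷ [])) μ
    relax {best = best} {x = x} at x-at low continue with x <? best
    ... | yes x<best =
      <-taken refl x<best $
      straight 1 (fits-cap x≤cap , tt) $
      jump! refl $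
      continue (<⇒≤ x<best) (x-at x≤cap) low
      where x≤cap = ≤-trans (<⇒≤ x<best) (Attains.capped at)
    ... | no x≮best = pad 1 $
      <-skipped refl x≮best $
      jump! refl $
      continue ≤-refl at λ j∈ P fit → ≤-trans (≮⇒≥ x≮best) (low j∈ P fit)

    module Try (j : Fin n) (j∈S : lookup S j ≡ true) where

      address u : ℕ
      address = base + code (S [ j ]≔ false)
      u       = μ address

      opt : Optimal (S [ j ]≔ false) u
      opt = table (S [ j ]≔ false) (code-remove-< S j j∈S)

      open Optimal opt using (capped)
      open Append j∈S opt

      kB≤cap : k * B ≤ cap
      kB≤cap = ≤-trans (m/n*n≤m u B) capped

      r≤u : r ≤ u
      r≤u = m∸n≤m u (k * B)

      fits-job : ∀ {x} → x ≤ u → x + p j < 2 ^ W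
      fits-job x≤u = fits₃ (≤-trans x≤u (≤-trans capped cap≤X²)) (≤-trans (p≤X j) (m≤m+n X X))

      append : ∀ {b ptr best out q pow w′ f} →
        Attains S best → Continue b ptr out q pow best j →
        Halts (7 + b) 49 (st ptr best out q pow (p j ∷ w′ ∷ d j ∷ k * B ∷ f ∷ u ∷ r + p j ∷ [])) μ
      append {best = best} at continue with d j <? r + p j
      ... | no fit = pad 1 $
        <-skipped refl fit $
        straight 1 (fits-job ≤-refl , tt) $
        jump! refl $
        relax at (same-machine (≮⇒≥ fit)) same-machine-lower continue
      ... | yes nofit with d j <? p j
      ...   | yes never = pad 5 $
        <-taken refl nofit $
        <-taken refl never $
        continue ≤-refl at (never-fits never best)
      ...   | no fresh =
        <-taken refl nofit $
        <-skipped refl fresh $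
        straight 2
          ( fits₃ (≤-trans kB≤cap cap≤X²) (≤-trans B≤X (m≤m+n X X))
          , subst (_< 2 ^ W) (sym (+-assoc _ B (p j))) (fits₃ (≤-trans kB≤cap cap≤X²) (+-mono-≤ B≤X (p≤X j)))
          , tt) $
        relax at (next-machine (≮⇒≥ fresh)) (next-machine-lower nofit) continue

      try : ∀ {b ptr best out q pow p′ w′ d′ e f a g} → p′ ≡ p j → d′ ≡ d j → a ≡ address →
        Attains S best → Continue b ptr out q pow best j →
        Halts (12 + b) 44 (st ptr best out q pow (p′ ∷ w′ ∷ d′ ∷ e ∷ f ∷ a ∷ g ∷ [])) μ
      try refl refl refl at continue =
        straight 5
          ( fits-cap (≤-trans (m/n≤m u B) capped)
          , fits-cap kB≤cap
          , fits-cap (≤-trans r≤u capped)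
          , fits-job r≤u
          , tt) $
        append at continue

    read-job : ∀ {b ptr best out q pow t₀ t₁ t₂ t₃ t₄ t₅ t₆} → 3 + ptr ≤ X →
      Halts b 36 (st (3 + ptr) best out q pow (μ ptr ∷ μ (1 + ptr) ∷ μ (2 + ptr) ∷ t₃ ∷ t₄ ∷ t₅ ∷ t₆ ∷ [])) μ →
      Halts (6 + b) 30 (st ptr best out q pow (t₀ ∷ t₁ ∷ t₂ ∷ t₃ ∷ t₄ ∷ t₅ ∷ t₆ ∷ [])) μ
    read-job le h = straight 6
      (fits₁ (m+n≤o⇒n≤o 2 le) , fits₁ (m+n≤o⇒n≤o 1 le) , fits₁ le , tt) h

    read-digit : ∀ {b ptr best out q pow t₀ t₁ t₂ t₃ t₄ t₅ t₆} → q ≤ X → pow + pow ≤ X →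
      Halts b 43 (st ptr best out (q / 2) (pow + pow)
        (t₀ ∷ t₁ ∷ t₂ ∷ q / 2 ∷ q ∸ (q / 2 + q / 2) ∷ base + (code S ∸ pow) ∷ t₆ ∷ [])) μ →
      Halts (7 + b) 36 (st ptr best out q pow (t₀ ∷ t₁ ∷ t₂ ∷ t₃ ∷ t₄ ∷ t₅ ∷ t₆ ∷ [])) μ
    read-digit {q = q} {pow} q≤X pow+pow≤X h = straight 7
      (fits₁ half≤X , fits₂ half≤X half≤X , fits₁ (≤-trans (m∸n≤m q (q / 2 + q / 2)) q≤X) , fits₁ half≤X ,
       fits₁ rest≤X , fits₂ base≤X rest≤X , fits₁ pow+pow≤X , tt) h
      where
      half≤X = ≤-trans (m/n≤m q 2) q≤X
      rest≤X = ≤-trans (m∸n≤m (code S) pow) (≤-trans (<⇒≤ (code<2^n S)) 2^n≤X)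

    -- The invariant speaks of a suffix of the jobs: `T` is the unread part of the mask, `g` sends
    -- its positions to jobs, `q` is its code, and `pow` is the power of two of the next job. With
    -- `g` the identity, `done` receives what `optimal-step` demands.
    jobs-loop : ∀ {k b} (T : Subset k) (g : Fin k → Fin n) {ptr best out q pow} (ts : Vec ℕ 7) →
      JobsAt μ ptr (p ∘ g) (w ∘ g) (d ∘ g) → ptr + 3 * k ≡ base →
      (∀ j → lookup T j ≡ lookup S (g j)) → q ≡ code T → q ≤ X →
      (∀ j → pow * 2 ^ toℕ j ≡ 2 ^ toℕ (g j)) → pow * 2 ^ k ≤ X →
      out + outsideSum (w ∘ g) T ≤ X → Attains S best →
      (∀ {ptr′ best′ out′ q′ pow′ ts′} → best′ ≤ best → Attains S best′ →
        (∀ j → LowerFor S best′ (g j)) → out′ ≡ out + outsideSum (w ∘ g) T →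
        Halts b 61 (st ptr′ best′ out′ q′ pow′ ts′) μ) →
      Halts (k * 27 + suc b) 29 (st ptr best out q pow ts) μ
    jobs-loop {zero} T g {ptr} {out = out} ts _ end _ _ _ _ _ _ at done =
      ≡-taken refl (trans (sym (+-identityʳ ptr)) end)
      (done ≤-refl at (λ ()) (sym (+-identityʳ out)))
    jobs-loop {suc k} {b} (x ∷ T) g {ptr} {best} {out} {q} {pow} (_ ∷ _ ∷ _ ∷ _ ∷ _ ∷ _ ∷ t₆ ∷ [])
      (pa , wa , da , rest) end T≡S q≡ q≤X pow≡ pow≤X out≤X at done =
      ≡-skipped refl (<⇒≢ (m+n≤o⇒n≤o 2 address)) $
      read-job (≤-trans address base≤X) $
      read-digit q≤X (≤-trans (m≤m*n (pow + pow) (2 ^ k) ⦃ m^n≢0 2 k ⦄) pow′≤X) $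
      branch x (T≡S zero) refl
      where
      address = job-address k end
      half≤X = ≤-trans (m/n≤m q 2) q≤X
      double : ∀ y → (pow + pow) * y ≡ pow * (2 * y)
      double y = trans (cong (_* y) (trans (cong (pow +_) (sym (+-identityʳ pow))) (*-comm 2 pow))) (*-assoc pow 2 y)
      pow′≤X = subst (_≤ X) (sym (double (2 ^ k))) pow≤X
      pow≡2^g : pow ≡ 2 ^ toℕ (g zero)
      pow≡2^g = trans (sym (*-identityʳ pow)) (pow≡ zero)
      j = g zero

      recurse : ∀ {best′ out′ ts′} → best′ ≤ best → Attains S best′ → LowerFor S best′ j →
        out′ + outsideSum (w ∘ g ∘ suc) T ≡ out + outsideSum (w ∘ g) (x ∷ T) →
        Halts (k * 27 + suc b) 29 (st (3 + ptr) best′ out′ (q / 2) (pow + pow) ts′) μ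
      recurse {ts′ = ts′} best′≤ at′ low out≡ =
        jobs-loop T (g ∘ suc) ts′ rest (next-job k end) (T≡S ∘ suc)
          (trans (cong (_/ 2) q≡) (code/2 x T)) half≤X
          (λ i → trans (double (2 ^ toℕ i)) (pow≡ (suc i))) pow′≤X
          (subst (_≤ X) (sym out≡) out≤X) at′
          λ best″≤ at″ lows out″≡ → done (≤-trans best″≤ best′≤) at″
            (λ { zero j∈ P fit → ≤-trans best″≤ (low j∈ P fit) ; (suc i) → lows i })
            (trans out″≡ out≡)

      branch : ∀ x′ → x′ ≡ lookup S j → x′ ≡ x →
        Halts (13 + (k * 27 + suc b)) 43
          (st (3 + ptr) best out (q / 2) (pow + pow)
            (μ ptr ∷ μ (1 + ptr) ∷ μ (2 + ptr) ∷ q / 2 ∷ q ∸ (q / 2 + q / 2) ∷ base + (code S ∸ pow) ∷ t₆ ∷ [])) μ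
      branch true x≡ refl =
        ≡-skipped refl (λ eq → 1+n≢0 (trans (sym (odd-digit true {S = T} q≡)) eq)) $
        Try.try j (sym x≡) pa da
          (cong (base +_) (trans (cong₂ _∸_ (sym (code-remove S j (sym x≡))) pow≡2^g) (m+n∸n≡m _ (2 ^ toℕ j))))
          at λ best′≤ at′ low → recurse best′≤ at′ low refl
      branch false x≡ refl = pad 10 $
        ≡-taken refl (odd-digit false {S = T} q≡) $
        straight 1 (fits₁ (≤-trans (m≤m+n _ _) (subst (_≤ X) (sym out≡) out≤X)) , tt) $
        jump! refl $
        recurse ≤-refl at (λ j∈ → ⊥-elim (false≢true (trans x≡ j∈))) out≡
        where
        false≢true : false ≢ true
        false≢true ()
        out≡ : out + μ (1 + ptr) + outsideSum (w ∘ g ∘ suc) T ≡ out + outsideSum (w ∘ g) (false ∷ T)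
        out≡ = trans (+-assoc out _ _) (cong (λ y → out + (y + outsideSum (w ∘ g ∘ suc) T)) wa)

    -- The premises of `done` are what preserves `IsLeast`: the answer does not grow, it accounts
    -- for S if S is feasible, and it is either the old one or the weight outside S.
    update : ∀ {b ptr best out q pow} (ts : Vec ℕ 7) → Optimal S best → out ≡ outsideSum w S → code S < N →
      (∀ {ans′ ts′} → ans′ ≤ ans → (Feasible S → ans′ ≤ outsideSum w S) →
        ans′ ≡ ans ⊎ (Feasible S × ans′ ≡ outsideSum w S) →
        Halts b 22 (file ans′ ptr base B N cap (suc (code S)) best out q pow ts′) (μ [ base + code S ≔ best ])) →
      Halts (7 + b) 61 (st ptr best out q pow ts) μ
    update {best = best} {out} (_ ∷ _ ∷ _ ∷ _ ∷ _ ∷ _ ∷ _ ∷ []) opt out≡ s<N done =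
      straight 1 (fits₂ base≤X (≤-trans (<⇒≤ s<N) 2^n≤X) , tt) $
      store! refl $
      straight 1 (fits₁ (≤-trans s<N 2^n≤X) , tt) $
      improve (best <? cap) (out <? ans)
      where
      improve : Dec (best < cap) → Dec (out < ans) → _
      improve (no best≮cap) _ = pad 2 $
        <-skipped refl best≮cap $
        jump! refl $
        done ≤-refl (⊥-elim ∘ best≮cap ∘ feasible⇒<cap opt) (inj₁ refl)
      improve (yes best<cap) (no out≮ans) = pad 1 $
        <-taken refl best<cap $
        <-skipped refl out≮ans $
        jump! refl $
        done ≤-refl (λ _ → subst (ans ≤_) out≡ (≮⇒≥ out≮ans)) (inj₁ refl)
      improve (yes best<cap) (yes out<ans) =
        <-taken refl best<cap $
        <-taken refl out<ans $
        straight 1 (fits₁ (≤-trans (≤-reflexive out≡) (≤-trans (outsideSum≤sum w S) Σw≤X)) , tt) $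
        jump! refl $
        done (<⇒≤ out<ans) (λ _ → ≤-reflexive out≡) (inj₂ (<cap⇒feasible opt best<cap , out≡))

  -- `Seen` holds of the masks enumerated so far; it grows from the empty set alone to all subsets.
  IsLeast : ℕ → (Subset n → Set) → Set
  IsLeast v Seen = (∀ S → Seen S → Feasible S → v ≤ outsideSum w S) × (∃[ S ] (Feasible S × v ≡ outsideSum w S))

  module _ (correct : ∀ {v} → IsLeast v (λ _ → ⊤) → Q v) where

    subsets-loop : ∀ x {s μ ans ptr best out q pow} (ts : Vec ℕ 7) → s + x ≡ N → 1 ≤ s → JobsAt μ 2 p w d →
      (∀ S → code S < s → Optimal S (μ (base + code S))) → IsLeast ans (λ S → code S < s) →
      Halts (x * (14 + n * 27) + 2) 22 (file ans ptr base B N cap s best out q pow ts) μ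
    subsets-loop zero {s} ts s≡N _ _ _ (least , attained) =
      <-skipped refl (<-irrefl s≡N′) $
      halt! refl (correct ((λ S _ → least S (subst (code S <_) (sym s≡N′) (code<2^n S))) , attained))
      where s≡N′ = trans (sym (+-identityʳ s)) s≡N
    subsets-loop (suc x) {s} {μ} {ans} (_ ∷ _ ∷ _ ∷ _ ∷ _ ∷ _ ∷ _ ∷ []) s+x≡N 1≤s jobs table (least , attained) =
      weaken (≤-reflexive (cost n (x * (14 + n * 27)))) $
      <-taken refl s<N $
      one-subset (decode n s s<N)
      where
      s<N : s < N
      s<N = subst (s <_) s+x≡N (m<m+n s (s≤s z≤n))

      -- The 6 is the loop test with five initialisations, `suc` the exit from the loop over the
      -- jobs, 7 the update, and 2 the last loop test with the halt.
      cost : ∀ n r → 6 + (n * 27 + suc (7 + (r + 2))) ≡ 14 + n * 27 + r + 2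
      cost = solve 2 (λ n r → con 6 :+ (n :* con 27 :+ (con 8 :+ (r :+ con 2))) := con 14 :+ n :* con 27 :+ r :+ con 2) refl

      one-subset : ∃[ S ] code {n} S ≡ s → _
      one-subset (S , refl) =
        straight 5 (fits-cap ≤-refl , fits₁ z≤n , fits₁ (≤-trans (<⇒≤ s<N) 2^n≤X) , fits₁ 1≤X , fits₁ 2≤X , tt) $
        Subsets.jobs-loop S μ ans table S (λ j → j) _ jobs (+-comm 2 (3 * n)) (λ _ → refl) refl
          (≤-trans (<⇒≤ s<N) 2^n≤X) (λ j → +-identityʳ (2 ^ toℕ j)) (≤-trans (≤-reflexive (+-identityʳ N)) 2^n≤X)
          (≤-trans (outsideSum≤sum w S) Σw≤X)
          (attains ≤-refl (λ lt → ⊥-elim (<-irrefl refl lt)))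
        λ {_} {best} {_} {_} {_} {ts} _ at low out≡ →
        -- The masks start at 1, so S is not empty.
        let opt = optimal-step (λ { refl → <⇒≢ 1≤s (sym (empty-code n)) }) at low in
        Subsets.update S μ ans table ts opt out≡ s<N
        λ {_} {ts} ans′≤ now origin →
        subsets-loop x ts (trans (sym (+-suc s x)) s+x≡N) (s≤s z≤n)
          (jobsAt-agree (+-comm 2 (3 * n)) (λ y y<base → ≔-other μ (<⇒≢ (<-≤-trans y<base (m≤m+n base s)))) jobs)
          (extend opt)
          ( (λ S′ S′≤s f → [ (λ S′<s → ≤-trans ans′≤ (least S′ S′<s f)) , (λ { refl → now f }) ]′ (split S′ S′≤s))
          , [ (λ { refl → attained }) , (λ new → S , new) ]′ origin)
        where
        split : ∀ S′ → code S′ < suc s → code S′ < s ⊎ S′ ≡ S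
        split S′ (s≤s le) = Sum.map₂ (code-injective S′ S) (m≤n⇒m<n∨m≡n le)

        extend : ∀ {best} → Optimal S best →
          ∀ S′ → code S′ < suc s → Optimal S′ ((μ [ base + s ≔ best ]) (base + code S′))
        extend opt S′ lt with split S′ lt
        ... | inj₁ S′<s = subst (Optimal S′) (sym (≔-other μ (<⇒≢ (+-monoʳ-< base S′<s)))) (table S′ S′<s)
        ... | inj₂ refl = subst (Optimal S) (sym (≔-here μ (base + s))) opt

    enumerate : ∀ {μ ptr ans D′ N′ best out q pow} (ts : Vec ℕ 7) → ans ≡ sum w → D′ ≡ sum d → N′ ≡ N →
      JobsAt μ 2 p w d → (∀ S → code S < 1 → Optimal S (μ (base + code S))) →
      IsLeast (sum w) (λ S → code S < 1) →
      Halts (2 + ((N ∸ 1) * (14 + n * 27) + 2)) 20 (file ans ptr base (suc D′) N′ m 0 best out q pow ts) μ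
    enumerate (_ ∷ _ ∷ _ ∷ _ ∷ _ ∷ _ ∷ _ ∷ []) refl refl refl jobs table least =
      straight 2 (fits-cap ≤-refl , fits₁ 1≤X , tt) $
      subsets-loop (N ∸ 1) _ (m+[n∸m]≡n (m^n>0 2 n)) ≤-refl jobs table least

    whole-program : ∀ μ → μ 0 ≡ n → μ 1 ≡ m → JobsAt μ 2 p w d →
      (∀ S → code S < 1 → Optimal S (μ (base + code S))) → IsLeast (sum w) (λ S → code S < 1) →
      Halts (time n) 0 (List.replicate 21 0) μ
    whole-program μ μ0≡n μ1≡m jobs table least =
      weaken cost $
      straight 10
        (fits₁ 1≤X , fits₁ 2≤X , fits (+-mono-≤ 1≤X² (+-mono-≤ 1≤X 1≤X)) ,
         fits₁ (subst (λ x → 3 * x ≤ X) (sym μ0≡n) (≤-trans (m≤m+n (3 * n) 2) base≤X)) ,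
         fits₁ (subst (λ x → 3 * x + 2 ≤ X) (sym μ0≡n) base≤X) , fits₁ 1≤X , fits₁ 1≤X , fits₁ 2≤X , tt) $
      subst₂ (λ n′ m′ → Halts _ 10 (file 0 2 (3 * n′ + 2) 1 1 m′ 0 0 0 0 0 (3 ∷ μ 0 ∷ 0 ∷ 0 ∷ 0 ∷ 0 ∷ 0 ∷ [])) μ)
        (sym μ0≡n) (sym μ1≡m) $
      setup w d jobs (+-comm 2 (3 * n)) Σw≤X B≤X (≤-trans (≤-reflexive (*-identityˡ N)) 2^n≤X)
      λ {t = t} _ ans≡ D≡ N≡ →
      enumerate (t ∷ μ 0 ∷ 0 ∷ 0 ∷ 0 ∷ 0 ∷ 0 ∷ []) ans≡ D≡ (trans N≡ (*-identityˡ N)) jobs table least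
      where
      1≤X² : 1 ≤ X * X
      1≤X² = *-mono-≤ 1≤X 1≤X
      total : ∀ a y → 10 + (a + suc (2 + (y + 2))) ≡ 15 + a + y
      total = solve 2 (λ a y → con 10 :+ (a :+ (con 3 :+ (y :+ con 2))) := con 15 :+ a :+ y) refl
      cost : 10 + (n * 10 + suc (2 + ((N ∸ 1) * (14 + n * 27) + 2))) ≤ time n
      cost = ≤-trans (≤-reflexive (total (n * 10) ((N ∸ 1) * (14 + n * 27))))
        (+-monoʳ-≤ (15 + n * 10) (*-monoˡ-≤ (14 + n * 27) (m∸n≤m N 1)))

-- Encoding length and layout of the input

k<2^bits : ∀ k → k < 2 ^ bits k
k<2^bits k = ≰⇒> λ 2^≤k → <-irrefl refl
  (subst (_≤ ⌊log₂ k ⌋) (⌊log₂[2^n]⌋≡n (bits k)) (⌊log₂⌋-mono-≤ 2^≤k))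

-- Since 1 + x + s is at most (1 + x)(1 + s), a sum is absorbed by a product of powers of two, and
-- in the product the lengths add up.
sum<2^encodingLength : ∀ xs → ListAction.sum xs < 2 ^ encodingLength xs
sum<2^encodingLength []       = s≤s z≤n
sum<2^encodingLength (x ∷ xs) = begin
  suc (x + ListAction.sum xs)                            ≤⟨ s≤s (+-monoʳ-≤ x (m≤m+n _ (x * ListAction.sum xs))) ⟩
  suc (x + (ListAction.sum xs + x * ListAction.sum xs))  ≡⟨ product x (ListAction.sum xs) ⟩
  suc x * suc (ListAction.sum xs)                        ≤⟨ *-mono-≤ (k<2^bits x) (sum<2^encodingLength xs) ⟩
  2 ^ bits x * 2 ^ encodingLength xs                     ≡⟨ ^-distribˡ-+-* 2 (bits x) _ ⟨
  2 ^ (bits x + encodingLength xs)                       ∎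
  where
  open ≤-Reasoning
  product : ∀ a b → suc (a + (b + a * b)) ≡ suc a * suc b
  product = solve 2 (λ a b → con 1 :+ (a :+ (b :+ a :* b)) := (con 1 :+ a) :* (con 1 :+ b)) refl

length≤encodingLength : ∀ xs → List.length xs ≤ encodingLength xs
length≤encodingLength []       = z≤n
length≤encodingLength (x ∷ xs) = +-mono-≤ (s≤s z≤n) (length≤encodingLength xs)

module Encoding {n : ℕ} (p w d : Fin n → ℕ) where

  record-of : Fin n → List ℕ
  record-of j = p j ∷ w j ∷ d j ∷ []

  -- `allFin` is `tabulate` of the identity; an arbitrary `g` admits induction over suffixes of the
  -- job list.
  flat : ∀ {k} → (Fin k → Fin n) → List ℕ
  flat g = List.concatMap record-of (List.tabulate g)

  length-flat : ∀ {k} (g : Fin k → Fin n) → List.length (flat g) ≡ k * 3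
  length-flat {zero}  g = refl
  length-flat {suc k} g = cong (3 +_) (length-flat (g ∘ suc))

  sum-flat : ∀ {k} (g : Fin k → Fin n) → ListAction.sum (flat g) ≡ sum (p ∘ g) + sum (w ∘ g) + sum (d ∘ g)
  sum-flat {zero}  g = refl
  sum-flat {suc k} g = trans
    (cong (λ x → p (g zero) + (w (g zero) + (d (g zero) + x))) (sum-flat (g ∘ suc)))
    (shuffle (p (g zero)) (w (g zero)) (d (g zero)) (sum (p ∘ g ∘ suc)) (sum (w ∘ g ∘ suc)) (sum (d ∘ g ∘ suc)))
    where
    shuffle : ∀ a b c x y z → a + (b + (c + (x + y + z))) ≡ a + x + (b + y) + (c + z)
    shuffle = solve 6 (λ a b c x y z → a :+ (b :+ (c :+ (x :+ y :+ z))) := a :+ x :+ (b :+ y) :+ (c :+ z)) refl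

  flat-jobsAt : ∀ {k} (g : Fin k → Fin n) {μ a} → (∀ i → μ (a + i) ≡ fromMaybe 0 (flat g ‼ i)) →
                JobsAt μ a (p ∘ g) (w ∘ g) (d ∘ g)
  flat-jobsAt {zero}  g _ = tt
  flat-jobsAt {suc k} g {μ} {a} at =
    trans (cong μ (sym (+-identityʳ a))) (at 0) , trans (cong μ (+-comm 1 a)) (at 1) , trans (cong μ (+-comm 2 a)) (at 2) ,
    flat-jobsAt (g ∘ suc) λ i → trans (cong μ (trans (cong (_+ i) (+-comm 3 a)) (+-assoc a 3 i))) (at (3 + i))

‼-beyond : ∀ (xs : List ℕ) i → List.length xs ≤ i → fromMaybe 0 (xs ‼ i) ≡ 0
‼-beyond []       i       _        = refl
‼-beyond (x ∷ xs) (suc i) (s≤s le) = ‼-beyond xs i le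

get-replicate : ∀ k i → get (List.replicate k 0) i ≡ 0
get-replicate zero    i       = refl
get-replicate (suc k) zero    = refl
get-replicate (suc k) (suc i) = get-replicate k i

-- The time bound and the conclusion

time∈O* : time ∈O* (λ n → 2 ^ n)
-- 66 = 15 + 10 + 14 + 27 adds up the coefficients in `time`. The threshold 1 is needed because
-- `n ^ 1` vanishes at 0.
time∈O* = 1 , 66 , 1 , bound
  where
  bound : ∀ n → 1 ≤ n → time n ≤ 66 * (2 ^ n * n ^ 1)
  bound n@(suc _) _ = begin
    15 + n * 10 + 2 ^ n * (14 + n * 27)             ≤⟨ +-mono-≤ (+-monoˡ-≤ (n * 10) (m≤n*m 15 n)) (*-monoʳ-≤ (2 ^ n) (+-monoˡ-≤ (n * 27) (m≤n*m 14 n))) ⟩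
    n * 15 + n * 10 + 2 ^ n * (n * 14 + n * 27)     ≡⟨ factor n (2 ^ n) ⟩
    25 * n + 41 * (2 ^ n * n)                       ≤⟨ +-monoˡ-≤ _ (*-monoʳ-≤ 25 (m≤n*m n (2 ^ n) ⦃ m^n≢0 2 n ⦄)) ⟩
    25 * (2 ^ n * n) + 41 * (2 ^ n * n)             ≡⟨ *-distribʳ-+ (2 ^ n * n) 25 41 ⟨
    66 * (2 ^ n * n)                                ≡⟨ cong (λ x → 66 * (2 ^ n * x)) (*-identityʳ n) ⟨
    66 * (2 ^ n * n ^ 1)                            ∎
    where
    open ≤-Reasoning
    factor : ∀ n e → n * 15 + n * 10 + e * (n * 14 + n * 27) ≡ 25 * n + 41 * (e * n)
    factor = solve 2 (λ n e → n :* con 15 :+ n :* con 10 :+ e :* (n :* con 14 :+ n :* con 27) := con 25 :* n :+ con 41 :* (e :* n)) refl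

module Solve {n : ℕ} (I : Jobs n) where
  open Jobs I
  open Packings p d
  open Encoding p w d

  input : List ℕ
  input = encodeJobs I

  L X : ℕ
  L = encodingLength input
  X = 2 ^ L

  length-input : List.length input ≡ 3 * n + 2
  length-input = trans (cong (2 +_) (trans (length-flat (λ j → j)) (*-comm n 3))) (+-comm 2 (3 * n))

  3n+2≤L : 3 * n + 2 ≤ L
  3n+2≤L = ≤-trans (≤-reflexive (sym length-input)) (length≤encodingLength input)

  4≤X : 4 ≤ X
  4≤X = ^-monoʳ-≤ 2 {2} (≤-trans (m≤n+m 2 (3 * n)) 3n+2≤L)

  -- The encoding spends at least one digit each on n and m, so X is at least 4 and X² + 2X ≤ 2X² <
  -- X³. This is the origin of the factor 3 in the word size.
  X-bound : ∀ {x} → x ≤ X * X + (X + X) → x < 2 ^ (3 * L)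
  X-bound {x} x≤ = begin-strict
    x                   ≤⟨ x≤ ⟩
    X * X + (X + X)     ≡⟨ cong (λ y → X * X + (X + y)) (+-identityʳ X) ⟨
    X * X + 2 * X       ≤⟨ +-monoʳ-≤ (X * X) (*-monoˡ-≤ X (≤-trans (s≤s (s≤s z≤n)) 4≤X)) ⟩
    X * X + X * X       ≡⟨ cong (X * X +_) (+-identityʳ (X * X)) ⟨
    2 * (X * X)         <⟨ *-monoˡ-< (X * X) ⦃ m*n≢0 X X ⦃ X≢0 ⦄ ⦃ X≢0 ⦄ ⦄ (≤-trans (s≤s (s≤s (s≤s z≤n))) 4≤X) ⟩
    X * (X * X)         ≡⟨ cong (λ y → X * (X * y)) (*-identityʳ X) ⟨
    X ^ 3               ≡⟨ ^-*-assoc 2 L 3 ⟩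
    2 ^ (L * 3)         ≡⟨ cong (2 ^_) (*-comm L 3) ⟩
    2 ^ (3 * L)         ∎
    where
    open ≤-Reasoning
    X≢0 = m^n≢0 2 L

  sums : ℕ
  sums = sum p + sum w + sum d

  n+m+sums<X : n + (m + sums) < X
  n+m+sums<X = subst (λ x → n + (m + x) < X) (sum-flat (λ j → j)) (sum<2^encodingLength input)

  sums<X : sums < X
  sums<X = ≤-<-trans (≤-trans (m≤n+m sums m) (m≤n+m _ n)) n+m+sums<X

  base≤X : 3 * n + 2 ≤ X
  base≤X = ≤-trans 3n+2≤L (<⇒≤ (k<2^k L))
    where
    k<2^k : ∀ k → k < 2 ^ k
    k<2^k zero    = s≤s z≤n
    k<2^k (suc k) = ≤-trans (+-mono-≤ (m^n>0 2 k) (k<2^k k)) (≤-reflexive (cong (2 ^ k +_) (sym (+-identityʳ (2 ^ k)))))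

  2^n≤X : 2 ^ n ≤ X
  2^n≤X = ^-monoʳ-≤ 2 (≤-trans (≤-trans (m≤m+n n (2 * n)) (m≤m+n (3 * n) 2)) 3n+2≤L)

  m≤X : m ≤ X
  m≤X = <⇒≤ (≤-<-trans (≤-trans (m≤m+n m sums) (m≤n+m _ n)) n+m+sums<X)

  p≤X : ∀ j → p j ≤ X
  p≤X j = <⇒≤ (≤-<-trans (≤-trans (≤sum p j) (≤-trans (m≤m+n _ (sum w)) (m≤m+n _ (sum d)))) sums<X)

  Σw≤X : sum w ≤ X
  Σw≤X = <⇒≤ (≤-<-trans (≤-trans (m≤n+m _ (sum p)) (m≤m+n _ (sum d))) sums<X)

  B≤X : suc (sum d) ≤ X
  B≤X = ≤-<-trans (m≤n+m (sum d) _) sums<X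

  open Table (sum d) m (≤sum d)
  open Correctness I (3 * L) X (IsMinTardyWeight I) X-bound base≤X 2^n≤X m≤X p≤X Σw≤X B≤X
  open Hoare (3 * L) program (IsMinTardyWeight I)

  correct : ∀ {v} → IsLeast v (λ _ → ⊤) → IsMinTardyWeight I v
  -- The schedule built from S is only known to have tardy weight at most `v`; the lower bound for
  -- all schedules, applied to it, yields equality.
  correct {v} (least , S , (k , c , k<m , P) , refl) = (schedule , ≤-antisym tardyWeight≤ (lower schedule)) , lower
    where
    open FromPacking I P k<m
    lower : ∀ σ → v ≤ tardyWeight I σ
    lower σ = subst (v ≤_) tardyWeight-early (least early tt packing-early)
      where open FromSchedule I σ

  memory : ℕ → ℕ
  memory = mem (initial input)

  ⊥-unique : ∀ (S : Subset n) → code S < 1 → S ≡ ⊥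
  ⊥-unique S (s≤s code≤0) = code-injective S ⊥ (trans (n≤0⇒n≡0 code≤0) (sym (empty-code n)))

  -- The entry of the empty set is never written: memory past the input holds 0, which is the right
  -- value.
  table₀ : ∀ (S : Subset n) → code S < 1 → Optimal S (memory (base + code S))
  table₀ S lt with refl ← ⊥-unique S lt = subst (Optimal ⊥)
    (sym (‼-beyond input (base + code (⊥ {n})) (≤-trans (≤-reflexive length-input) (m≤m+n base _)))) optimal-⊥

  least₀ : IsLeast (sum w) (λ S → code S < 1)
  least₀ = (λ S lt _ → ≤-reflexive (trans (sym outside⊥) (cong (outsideSum w) (sym (⊥-unique S lt))))) ,
           ⊥ , (0 , 0 , m≥1 , empty) , sym outside⊥
    where
    outside⊥ : outsideSum w ⊥ ≡ sum w
    outside⊥ = sum-cong-≗ λ j → cong (λ b → if b then 0 else w j) (lookup-replicate j false)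

  halts-program : Halts (time n) 0 (List.replicate 21 0) memory
  halts-program = whole-program correct memory refl refl (flat-jobsAt (λ j → j) (λ _ → refl)) table₀ least₀

theorem2 : ∃[ T ] (T ∈O* (λ n → 2 ^ n) × P‖ΣwU SolvableInTime T)
theorem2 = time , time∈O* , program , 3 , _ , λ I →
  let v , t , run , answer , t≤ = Hoare.Halts.run (Solve.halts-program I) (λ _ → 0) (λ i → sym (get-replicate 21 i))
  in v , t , run , answer , t≤
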